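{- Let $n$ be a positive integer and let $\varepsilon_1, \ldots, \varepsilon_n$ be i.i.d. Rademacher random variables. Define $a_i = 3i + \varepsilon_i$ for $1 \leq i \leq n$, let $p_i = \sum_{j=1}^{i} a_j$ for $0 \leq i \leq n$, and let $P(a) = \{p_0, p_1, \ldots, p_n\}$. Then the expected value of $E(P(a))$ is $O(n^2)$, i.e. there is an absolute constant $C>0$ with $\mathbb{E}[E(P(a))] \leq C n^2$ for all $n$.
   Context: A Rademacher random variable takes the values $1$ and $-1$ each with probability $\frac{1}{2}$. For a finite non-empty set $P \subseteq \mathbb{Z}$, its additive energy is $E(P) = |\{(x,y,z,w) \in P^4 \mid x - y = z - w\}|$. -}

module Defs where

open import Data.Bool using (Bool; true; false; if_then_else_)
open import Data.Nat using (ℕ; zero; suc; _*_)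
open import Data.Integer as ℤ using (ℤ; +_; -[1+_]) renaming (_+_ to _+ℤ_; _-_ to _-ℤ_)
open import Data.List using (List; []; _∷_; map; deduplicate; _++_)
open import Data.Nat.ListAction using (sum)
open import Data.Vec using (Vec; []; _∷_)
open import Relation.Nullary.Decidable using (⌊_⌋)

sign : Bool → ℤ
sign true  = + 1
sign false = -[1+ 0 ]

aTerm : ℕ → Bool → ℤ
aTerm i b = (+ (3 * i)) +ℤ sign b

psums : ∀ {m} → ℕ → ℤ → Vec Bool m → List ℤ
psums i s []       = s ∷ []
psums i s (b ∷ bs) = s ∷ psums (suc i) (s +ℤ aTerm i b) bs

pointList : ∀ {n} → Vec Bool n → List ℤ
pointList ε = psums 1 (+ 0) ε

-- Additive energy of the finite set of elements of a list
-- (duplicates removed, so this is E of the underlying set).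
energy : List ℤ → ℕ
energy L =
  let D = deduplicate ℤ._≟_ L in
  sum (map (λ x → sum (map (λ y → sum (map (λ z → sum (map (λ w →
    if ⌊ (x -ℤ y) ℤ.≟ (z -ℤ w) ⌋ then 1 else 0) D)) D)) D)) D)

energyP : ∀ {n} → Vec Bool n → ℕ
energyP ε = energy (pointList ε)

allSigns : (n : ℕ) → List (Vec Bool n)
allSigns zero    = [] ∷ []
allSigns (suc n) = map (true ∷_) (allSigns n) ++ map (false ∷_) (allSigns n)

-- Sum over all outcomes of E(P(a)); the expectation is this divided by 2^n.
totalEnergy : (n : ℕ) → ℕ
totalEnergy n = sum (map energyP (allSigns n))

{-# OPTIONS --safe #-}

-- A nontrivial coincidence x − y = z − w among the points amounts to equal sums of steps over two disjoint
-- blocks: d < c ≤ b < a with p_c − p_d = p_a − p_b. Write u = c − d and v = a − b. Increasing steps force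
-- v < u, and with K a Binomial(u + v, 1/2) variable the coincidence reads
-- 3 v b + const = 3 u d + const + 2 K. Let g = gcd(u, v). For fixed u, v and K the solutions b lie in one
-- residue class mod u/g, so there are at most 1 + N g / u pairs (d, b), where N = n + 1, and none unless 2 K
-- lies in one residue class mod g, which has probability at most 2/g + 2/√u. Hence the pair (u, v) contributes
-- at most 4 + 2 N (1 + g/√u) / u. The gcds of u with 1, …, u sum to at most u times the number of divisors
-- of u, hence to at most 2 u √u, so that each u contributes O(N).

module Submission where

open import Defs
open import Data.Nat using (ℕ; _*_; _^_; _≤_; _≥_; _>_)
open import Data.Product using (Σ; _×_)
open import Data.Bool using (Bool; true; false; if_then_else_)
open import Data.Integer as ℤ using (ℤ)
import Data.Integer.Properties as ℤ
import Data.Integer.Tactic.RingSolver as ℤ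
open import Data.List using (List; []; _∷_; map; length; upTo; applyUpTo; filter; deduplicate) renaming (_++_ to _++ᴸ_)
open import Data.List.Membership.Propositional using (_∈_)
open import Data.List.Membership.Propositional.Properties using (∈-upTo⁺; ∈-upTo⁻)
open import Data.List.Properties using (map-++; map-∘; map-upTo; map-applyUpTo; upTo-∷ʳ; length-upTo; length-map; length-++)
open import Data.List.Relation.Unary.Any using (here; there)
open import Data.Nat
open import Data.Nat.DivMod using (_%_; _/_; m≡m%n+[m/n]*n; m%n≤n; m%n≤m; %-distribˡ-+; [m+kn]%n≡m%n)
open import Data.Nat.Divisibility
open import Data.Nat.GCD using (gcd; gcd[m,n]∣m; gcd[m,n]∣n; gcd-greatest; gcd[m,n]≢0; c*gcd[m,n]≡gcd[cm,cn])
open import Data.Nat.ListAction using (sum)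
open import Data.Nat.ListAction.Properties using (sum-++)
open import Data.Nat.Properties
open import Data.Nat.Tactic.RingSolver using (solve-∀)
open import Data.Product using (_,_; ∃; proj₂)
open import Data.Sum using (_⊎_; inj₁; inj₂)
open import Data.Vec using (Vec; []; _∷_; _++_)
open import Function using (_∘_)
open import Relation.Binary.Definitions using (DecidableEquality; tri<; tri≈; tri>)
open import Relation.Binary.PropositionalEquality
open import Relation.Nullary using (¬_; Dec; yes; no; contradiction)
open import Relation.Nullary.Decidable using (⌊_⌋; _×-dec_; _⊎-dec_)
open import Relation.Unary using (Pred; Decidable)

-- Writing the relation as x + w = z + y is what makes the two blocks disjoint: of two distinct
-- pairs with equal sums one is nested inside the other, and the two gaps between them carry
-- independent signs. The signs have to save a logarithm. If every pair (u, v) were solvable, the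
-- counts N g / u would add up to order N² log N, because the gcds of u with 1, ..., u average to a
-- logarithm; a probability of order 1/g cancels the factor g. That probability comes from the
-- second moment of the walk alone, by comparing the laws of K and K + 1, with no estimate of
-- binomial coefficients. All computations stay in the natural numbers: expectations are sums over
-- sign vectors with powers of 2 carried along, denominators are cleared, and √u is replaced by an
-- integer s with s² ≤ u < (s + 1)².

private variable
  A B : Set
  P Q R : Set

-- Finite sums and indicators

∑ : List A → (A → ℕ) → ℕ
∑ xs f = sum (map f xs)

syntax ∑ xs (λ x → e) = ∑[ x ← xs ] e

∑-mono-∈ : ∀ (xs : List A) {f g} → (∀ x → x ∈ xs → f x ≤ g x) → ∑ xs f ≤ ∑ xs g
∑-mono-∈ []       f≤g = z≤n
∑-mono-∈ (x ∷ xs) f≤g = +-mono-≤ (f≤g x (here refl)) (∑-mono-∈ xs λ y y∈ → f≤g y (there y∈))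

∑-mono : ∀ (xs : List A) {f g} → (∀ x → f x ≤ g x) → ∑ xs f ≤ ∑ xs g
∑-mono xs f≤g = ∑-mono-∈ xs λ x _ → f≤g x

∑-cong : ∀ (xs : List A) {f g} → (∀ x → f x ≡ g x) → ∑ xs f ≡ ∑ xs g
∑-cong []       f≡g = refl
∑-cong (x ∷ xs) f≡g = cong₂ _+_ (f≡g x) (∑-cong xs f≡g)

∑-distrib-+ : ∀ (xs : List A) f g → ∑[ x ← xs ] (f x + g x) ≡ ∑ xs f + ∑ xs g
∑-distrib-+ []       f g = refl
∑-distrib-+ (x ∷ xs) f g rewrite ∑-distrib-+ xs f g = eq (f x) (g x) (∑ xs f) (∑ xs g)
  where
  eq : ∀ a b c d → (a + b) + (c + d) ≡ (a + c) + (b + d)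
  eq = solve-∀

*-distribˡ-∑ : ∀ c (xs : List A) f → c * ∑ xs f ≡ ∑[ x ← xs ] (c * f x)
*-distribˡ-∑ c []       f = *-zeroʳ c
*-distribˡ-∑ c (x ∷ xs) f = trans (*-distribˡ-+ c (f x) _) (cong (c * f x +_) (*-distribˡ-∑ c xs f))

∑-const : ∀ (xs : List A) c → ∑[ _ ← xs ] c ≡ length xs * c
∑-const []       c = refl
∑-const (x ∷ xs) c = cong (c +_) (∑-const xs c)

∑-zero : ∀ (xs : List A) {f} → (∀ x → f x ≡ 0) → ∑ xs f ≡ 0
∑-zero xs f≡0 = trans (∑-cong xs f≡0) (trans (∑-const xs 0) (*-zeroʳ (length xs)))

∑-swap : ∀ (xs : List A) (ys : List B) (f : A → B → ℕ) →
         ∑[ x ← xs ] ∑[ y ← ys ] f x y ≡ ∑[ y ← ys ] ∑[ x ← xs ] f x y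
∑-swap []       ys f = sym (∑-zero ys λ _ → refl)
∑-swap (x ∷ xs) ys f = trans (cong (∑ ys (f x) +_) (∑-swap xs ys f)) (sym (∑-distrib-+ ys _ _))

∑-++ : ∀ (xs ys : List A) f → ∑ (xs ++ᴸ ys) f ≡ ∑ xs f + ∑ ys f
∑-++ xs ys f = trans (cong sum (map-++ f xs ys)) (sum-++ (map f xs) (map f ys))

∑-map : ∀ (g : A → B) xs f → ∑ (map g xs) f ≡ ∑ xs (f ∘ g)
∑-map g xs f = cong sum (sym (map-∘ xs))

term≤∑ : ∀ {xs : List A} f {x} → x ∈ xs → f x ≤ ∑ xs f
term≤∑ f (here refl) = m≤m+n _ _
term≤∑ f (there x∈)  = m≤n⇒m≤o+n _ (term≤∑ f x∈)

∑-positive⁻ : ∀ (xs : List A) f → 0 < ∑ xs f → ∃ λ x → 0 < f x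
∑-positive⁻ (x ∷ xs) f 0<∑ with f x in eq
... | suc _ = x , subst (0 <_) (sym eq) z<s
... | zero  = ∑-positive⁻ xs f 0<∑

∑-deduplicate : ∀ (_≟ᴬ_ : DecidableEquality A) xs f → ∑ (deduplicate _≟ᴬ_ xs) f ≤ ∑ xs f
∑-deduplicate _≟ᴬ_ []       f = z≤n
∑-deduplicate _≟ᴬ_ (x ∷ xs) f = +-monoʳ-≤ (f x) (≤-trans (∑-filter _ (deduplicate _≟ᴬ_ xs)) (∑-deduplicate _≟ᴬ_ xs f))
  where
  ∑-filter : ∀ {P : Pred _ _} (P? : Decidable P) ys → ∑ (filter P? ys) f ≤ ∑ ys f
  ∑-filter P? []       = z≤n
  ∑-filter P? (y ∷ ys) with P? y
  ... | yes _ = +-monoʳ-≤ (f y) (∑-filter P? ys)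
  ... | no  _ = m≤n⇒m≤o+n (f y) (∑-filter P? ys)

∑-upTo-suc : ∀ n f → ∑ (upTo (suc n)) f ≡ ∑ (upTo n) f + f n
∑-upTo-suc n f = begin
  ∑ (upTo (suc n)) f         ≡⟨ cong (λ xs → ∑ xs f) (upTo-∷ʳ n) ⟨
  ∑ (upTo n ++ᴸ n ∷ []) f    ≡⟨ ∑-++ (upTo n) (n ∷ []) f ⟩
  ∑ (upTo n) f + (f n + 0)   ≡⟨ cong (∑ (upTo n) f +_) (+-identityʳ (f n)) ⟩
  ∑ (upTo n) f + f n         ∎
  where open ≡-Reasoning

∑-upTo-const : ∀ n c → ∑[ _ ← upTo n ] c ≡ n * c
∑-upTo-const n c = trans (∑-const (upTo n) c) (cong (_* c) (length-upTo n))

∑-upTo-monoˡ : ∀ {m n} f → m ≤ n → ∑ (upTo m) f ≤ ∑ (upTo n) f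
∑-upTo-monoˡ {m} f m≤n with k , refl ← m≤n⇒∃[o]m+o≡n m≤n = extend m k
  where
  extend : ∀ m k → ∑ (upTo m) f ≤ ∑ (upTo (m + k)) f
  extend m zero    rewrite +-identityʳ m = ≤-refl
  extend m (suc k) rewrite +-suc m k | ∑-upTo-suc (m + k) f = m≤n⇒m≤n+o (f (m + k)) (extend m k)

∑-upTo-truncate : ∀ m n f → (∀ k → n ≤ k → f k ≡ 0) → ∑ (upTo m) f ≤ ∑ (upTo n) f
∑-upTo-truncate zero    n f f≡0 = z≤n
∑-upTo-truncate (suc m) n f f≡0 with n ≤? m
... | yes n≤m rewrite ∑-upTo-suc m f | f≡0 m n≤m | +-identityʳ (∑ (upTo m) f) = ∑-upTo-truncate m n f f≡0
... | no  n≰m = ∑-upTo-monoˡ f (≰⇒> n≰m)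

-- Changes the variable from the end c of a block to its length c - d. The new range may reach
-- beyond n, which is harmless for an upper bound.
∑-upTo-shift : ∀ n d f → (∀ c → c ≤ d → f c ≡ 0) → ∑ (upTo n) f ≤ ∑[ u ← upTo n ] f (d + suc u)
∑-upTo-shift n d f f≡0 =
  ≤-trans (∑-upTo-monoˡ f (m≤n+m n (suc d))) (≤-reflexive (shifted n))
  where
  prefix : ∀ k → k ≤ suc d → ∑ (upTo k) f ≡ 0
  prefix zero    _   = refl
  prefix (suc k) k<d rewrite ∑-upTo-suc k f | f≡0 k (s≤s⁻¹ k<d) | prefix k (≤-trans (n≤1+n k) k<d) = refl
  shifted : ∀ k → ∑ (upTo (suc d + k)) f ≡ ∑[ u ← upTo k ] f (d + suc u)
  shifted zero    rewrite +-identityʳ d = prefix (suc d) ≤-refl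
  shifted (suc k) rewrite +-suc d k | ∑-upTo-suc (suc (d + k)) f | shifted k
                        | ∑-upTo-suc k (λ u → f (d + suc u)) | +-suc d k = refl

-- The same conditional as in `energy`, so that the summand there is by definition an `ind`.
ind : Dec P → ℕ
ind P? = if ⌊ P? ⌋ then 1 else 0

ind-mono : (P? : Dec P) (Q? : Dec Q) → (P → Q) → ind P? ≤ ind Q?
ind-mono (no _)  Q?      P⇒Q = z≤n
ind-mono (yes p) (yes _) P⇒Q = ≤-refl
ind-mono (yes p) (no ¬q) P⇒Q = contradiction (P⇒Q p) ¬q

ind-⊎ : (P? : Dec P) (Q? : Dec Q) (R? : Dec R) → (P → Q ⊎ R) → ind P? ≤ ind Q? + ind R?
ind-⊎ (no _)  Q? R? P⇒ = z≤n
ind-⊎ (yes p) Q? R? P⇒ with P⇒ p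
... | inj₁ q = m≤n⇒m≤n+o (ind R?) (ind-mono (yes p) Q? λ _ → q)
... | inj₂ r = m≤n⇒m≤o+n (ind Q?) (ind-mono (yes p) R? λ _ → r)

ind-× : (P? : Dec P) (Q? : Dec Q) → ind (P? ×-dec Q?) ≡ ind P? * ind Q?
ind-× (no _)  Q?      = refl
ind-× (yes _) (no _)  = refl
ind-× (yes _) (yes _) = refl

ind≤1 : (P? : Dec P) → ind P? ≤ 1
ind≤1 (yes _) = ≤-refl
ind≤1 (no _)  = z≤n

ind-no : (P? : Dec P) → ¬ P → ind P? ≡ 0
ind-no (yes p) ¬p = contradiction p ¬p
ind-no (no _)  ¬p = refl

ind-positive⁻ : (P? : Dec P) → 0 < ind P? → P
ind-positive⁻ (yes p) _ = p

-- The invariant carries the last point counted, from which the next one keeps its distance.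
∑-spaced : ∀ u g f → (∀ b → f b ≤ 1) →
           (∀ b c → 0 < f b → 0 < f c → b < c → u + g * b ≤ g * c) →
           ∀ n → u * ∑ (upTo n) f ≤ g * n + u
∑-spaced u g f f≤1 spaced n with invariant n
  where
  invariant : ∀ n → ∑ (upTo n) f ≡ 0 ⊎ ∃ λ b → b < n × 0 < f b × u * ∑ (upTo n) f ≤ g * b + u
  invariant zero = inj₁ refl
  invariant (suc n) rewrite ∑-upTo-suc n f with f n in fn≡ | f≤1 n | invariant n
  ... | 0 | _ | inj₁ ∑≡0 rewrite ∑≡0 = inj₁ refl
  ... | 0 | _ | inj₂ (b , b<n , 0<fb , bound) rewrite +-identityʳ (∑ (upTo n) f) =
    inj₂ (b , m<n⇒m<1+n b<n , 0<fb , bound)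
  ... | 1 | _ | inj₁ ∑≡0 rewrite ∑≡0 | *-identityʳ u =
    inj₂ (n , n<1+n n , subst (0 <_) (sym fn≡) z<s , m≤n+m u (g * n))
  ... | 1 | _ | inj₂ (b , b<n , 0<fb , bound) = inj₂ (n , n<1+n n , 0<fn , (begin
      u * (∑ (upTo n) f + 1)   ≡⟨ *-distribˡ-+ u _ 1 ⟩
      u * ∑ (upTo n) f + u * 1 ≤⟨ +-mono-≤ bound (≤-reflexive (*-identityʳ u)) ⟩
      g * b + u + u            ≡⟨ cong (_+ u) (+-comm (g * b) u) ⟩
      u + g * b + u            ≤⟨ +-monoˡ-≤ u (spaced b n 0<fb 0<fn b<n) ⟩
      g * n + u                ∎))
    where
    open ≤-Reasoning
    0<fn : 0 < f n
    0<fn = subst (0 <_) (sym fn≡) z<s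
  ... | suc (suc _) | s≤s () | _
... | inj₁ ∑≡0 rewrite ∑≡0 | *-zeroʳ u = z≤n
... | inj₂ (b , b<n , _ , bound) = ≤-trans bound (+-monoˡ-≤ u (*-monoʳ-≤ g (<⇒≤ b<n)))

-- With at most one solution every spacing condition is vacuous. Spacing n + 1 gives (n + 1) S ≤ 2 n
-- + 1 for the number S of solutions, so S < 2.
∑-unique : ∀ n {P : ℕ → Set} (P? : ∀ k → Dec (P k)) →
           (∀ i j → P i → P j → i ≡ j) → ∑[ k ← upTo n ] ind (P? k) ≤ 1
∑-unique n P? unique = s≤s⁻¹ (*-cancelˡ-< (suc n) _ 2 (begin-strict
  suc n * ∑[ k ← upTo n ] ind (P? k) ≤⟨ ∑-spaced (suc n) 1 _ (λ k → ind≤1 (P? k)) spaced n ⟩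
  1 * n + suc n                      <⟨ n<1+n _ ⟩
  suc (1 * n + suc n)                ≡⟨ eq n ⟩
  suc n * 2                          ∎))
  where
  open ≤-Reasoning
  eq : ∀ n → suc (1 * n + suc n) ≡ suc n * 2
  eq = solve-∀
  spaced : ∀ b c → 0 < ind (P? b) → 0 < ind (P? c) → b < c → suc n + 1 * b ≤ 1 * c
  spaced b c 0<b 0<c b<c =
    contradiction (unique b c (ind-positive⁻ (P? b) 0<b) (ind-positive⁻ (P? c) 0<c)) (<⇒≢ b<c)

-- Sums over sign vectors

trues : ∀ {m} → Vec Bool m → ℕ
trues []          = 0
trues (true ∷ ε)  = suc (trues ε)
trues (false ∷ ε) = trues ε

falses : ∀ {m} → Vec Bool m → ℕ
falses []          = 0
falses (true ∷ ε)  = falses ε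
falses (false ∷ ε) = suc (falses ε)

trues+falses : ∀ {m} (ε : Vec Bool m) → trues ε + falses ε ≡ m
trues+falses []          = refl
trues+falses (true ∷ ε)  = cong suc (trues+falses ε)
trues+falses (false ∷ ε) = trans (+-suc (trues ε) (falses ε)) (cong suc (trues+falses ε))

trues-++ : ∀ {m n} (α : Vec Bool m) (β : Vec Bool n) → trues (α ++ β) ≡ trues α + trues β
trues-++ []          β = refl
trues-++ (true ∷ α)  β = cong suc (trues-++ α β)
trues-++ (false ∷ α) β = trues-++ α β

∑-signs-suc : ∀ m (F : Vec Bool (suc m) → ℕ) →
              ∑ (allSigns (suc m)) F ≡ ∑[ ε ← allSigns m ] F (true ∷ ε) + ∑[ ε ← allSigns m ] F (false ∷ ε)
∑-signs-suc m F = trans (∑-++ (map (true ∷_) (allSigns m)) _ F)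
  (cong₂ _+_ (∑-map (true ∷_) (allSigns m) F) (∑-map (false ∷_) (allSigns m) F))

length-allSigns : ∀ m → length (allSigns m) ≡ 2 ^ m
length-allSigns zero = refl
length-allSigns (suc m) rewrite length-++ (map (Vec._∷_ true) (allSigns m)) {map (false ∷_) (allSigns m)}
  | length-map (Vec._∷_ true) (allSigns m) | length-map (Vec._∷_ false) (allSigns m)
  | length-allSigns m | +-identityʳ (2 ^ m) = refl

∑-signs-const : ∀ m c → ∑[ _ ← allSigns m ] c ≡ 2 ^ m * c
∑-signs-const m c = trans (∑-const (allSigns m) c) (cong (_* c) (length-allSigns m))

∑-signs-++ : ∀ m n (F : Vec Bool (m + n) → ℕ) →
             ∑ (allSigns (m + n)) F ≡ ∑[ α ← allSigns m ] ∑[ β ← allSigns n ] F (α ++ β)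
∑-signs-++ zero    n F = sym (+-identityʳ _)
∑-signs-++ (suc m) n F = begin
  ∑ (allSigns (suc m + n)) F                                     ≡⟨ ∑-signs-suc (m + n) F ⟩
  ∑ (allSigns (m + n)) (F ∘ (true ∷_)) + ∑ (allSigns (m + n)) (F ∘ (false ∷_))
    ≡⟨ cong₂ _+_ (∑-signs-++ m n _) (∑-signs-++ m n _) ⟩
  ∑[ α ← allSigns m ] ∑[ β ← allSigns n ] F (true ∷ α ++ β)
    + ∑[ α ← allSigns m ] ∑[ β ← allSigns n ] F (false ∷ α ++ β) ≡⟨ ∑-signs-suc m _ ⟨
  ∑[ α ← allSigns (suc m) ] ∑[ β ← allSigns n ] F (α ++ β)       ∎
  where open ≡-Reasoning

-- A fair sign is symmetric: in the induction the two halves of `allSigns (suc m)` trade places.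
∑-falses : ∀ m (φ : ℕ → ℕ) → ∑[ ε ← allSigns m ] φ (falses ε) ≡ ∑[ ε ← allSigns m ] φ (trues ε)
∑-falses zero    φ = refl
∑-falses (suc m) φ = begin
  ∑[ ε ← allSigns (suc m) ] φ (falses ε)
    ≡⟨ ∑-signs-suc m _ ⟩
  ∑[ ε ← allSigns m ] φ (falses ε) + ∑[ ε ← allSigns m ] φ (suc (falses ε))
    ≡⟨ cong₂ _+_ (∑-falses m φ) (∑-falses m (φ ∘ suc)) ⟩
  ∑[ ε ← allSigns m ] φ (trues ε) + ∑[ ε ← allSigns m ] φ (suc (trues ε))
    ≡⟨ +-comm (∑ (allSigns m) (φ ∘ trues)) _ ⟩
  ∑[ ε ← allSigns m ] φ (suc (trues ε)) + ∑[ ε ← allSigns m ] φ (trues ε)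
    ≡⟨ ∑-signs-suc m _ ⟨
  ∑[ ε ← allSigns (suc m) ] φ (trues ε)                                     ∎
  where open ≡-Reasoning

-- The counts from both blocks merge into one binomial variable, so equidistribution is needed for a
-- single variable only.
∑-trues+falses : ∀ u v (φ : ℕ → ℕ) →
  ∑[ α ← allSigns u ] ∑[ β ← allSigns v ] φ (trues α + falses β) ≡ ∑[ ε ← allSigns (u + v) ] φ (trues ε)
∑-trues+falses u v φ = begin
  ∑[ α ← allSigns u ] ∑[ β ← allSigns v ] φ (trues α + falses β)
    ≡⟨ ∑-cong (allSigns u) (λ α → ∑-falses v λ k → φ (trues α + k)) ⟩
  ∑[ α ← allSigns u ] ∑[ β ← allSigns v ] φ (trues α + trues β)
    ≡⟨ ∑-cong (allSigns u) (λ α → ∑-cong (allSigns v) λ β → cong φ (trues-++ α β)) ⟨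
  ∑[ α ← allSigns u ] ∑[ β ← allSigns v ] φ (trues (α ++ β))
    ≡⟨ ∑-signs-++ u v (φ ∘ trues) ⟨
  ∑[ ε ← allSigns (u + v) ] φ (trues ε) ∎
  where open ≡-Reasoning

-- Anticoncentration of the binomial distribution modulo g

-- The absorption identity k C(m+1, k) = (m+1) C(m, k-1), summed against h: singling out one `true`
-- and deleting it leaves m signs.
∑-trues-weighted : ∀ m (h : ℕ → ℕ) →
  ∑[ ε ← allSigns (suc m) ] (trues ε * h (trues ε)) ≡ suc m * ∑[ ε ← allSigns m ] h (suc (trues ε))
∑-trues-weighted zero    h = refl
∑-trues-weighted (suc m) h = begin
  ∑[ ε ← allSigns (2 + m) ] (trues ε * h (trues ε))
    ≡⟨ ∑-signs-suc (suc m) _ ⟩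
  ∑[ ε ← allSigns (suc m) ] (h (suc (trues ε)) + trues ε * h (suc (trues ε))) + ∑[ ε ← allSigns (suc m) ] (trues ε * h (trues ε))
    ≡⟨ cong₂ _+_ (∑-distrib-+ (allSigns (suc m)) _ _) (∑-trues-weighted m h) ⟩
  (H + ∑[ ε ← allSigns (suc m) ] (trues ε * h (suc (trues ε)))) + suc m * H₁
    ≡⟨ cong (λ x → H + x + suc m * H₁) (∑-trues-weighted m (h ∘ suc)) ⟩
  (H + suc m * H₂) + suc m * H₁
    ≡⟨ eq H H₂ H₁ m ⟩
  H + suc m * (H₂ + H₁)
    ≡⟨ cong (λ x → H + suc m * x) (∑-signs-suc m _) ⟨
  suc (suc m) * H ∎
  where
  open ≡-Reasoning
  H H₁ H₂ : ℕ
  H  = ∑[ ε ← allSigns (suc m) ] h (suc (trues ε))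
  H₁ = ∑[ ε ← allSigns m ] h (suc (trues ε))
  H₂ = ∑[ ε ← allSigns m ] h (suc (suc (trues ε)))
  eq : ∀ a b c m → (a + suc m * b) + suc m * c ≡ a + suc m * (b + c)
  eq = solve-∀

-- The mirror identity (m+1-k) C(m+1, k) = (m+1) C(m, k). Together the two express the averages of h
-- at T and at T + 1 by weights F and T on one and the same space.
∑-falses-weighted : ∀ m (h : ℕ → ℕ) →
  ∑[ ε ← allSigns (suc m) ] (falses ε * h (trues ε)) ≡ suc m * ∑[ ε ← allSigns m ] h (trues ε)
∑-falses-weighted zero    h = refl
∑-falses-weighted (suc m) h = begin
  ∑[ ε ← allSigns (2 + m) ] (falses ε * h (trues ε))
    ≡⟨ ∑-signs-suc (suc m) _ ⟩
  ∑[ ε ← allSigns (suc m) ] (falses ε * h (suc (trues ε))) + ∑[ ε ← allSigns (suc m) ] (h (trues ε) + falses ε * h (trues ε))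
    ≡⟨ cong₂ _+_ (∑-falses-weighted m (h ∘ suc)) (∑-distrib-+ (allSigns (suc m)) _ _) ⟩
  suc m * H₁ + (H + ∑[ ε ← allSigns (suc m) ] (falses ε * h (trues ε)))
    ≡⟨ cong (λ x → suc m * H₁ + (H + x)) (∑-falses-weighted m h) ⟩
  suc m * H₁ + (H + suc m * H₀)
    ≡⟨ eq H H₁ H₀ m ⟩
  H + suc m * (H₁ + H₀)
    ≡⟨ cong (λ x → H + suc m * x) (∑-signs-suc m _) ⟨
  suc (suc m) * H ∎
  where
  open ≡-Reasoning
  H H₀ H₁ : ℕ
  H  = ∑[ ε ← allSigns (suc m) ] h (trues ε)
  H₀ = ∑[ ε ← allSigns m ] h (trues ε)
  H₁ = ∑[ ε ← allSigns m ] h (suc (trues ε))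
  eq : ∀ a b c m → suc m * b + (a + suc m * c) ≡ a + suc m * (b + c)
  eq = solve-∀

-- The variance of the simple random walk, E (F − T)² = m, with both sides moved so that no subtraction occurs.
∑-variance : ∀ m → ∑[ ε ← allSigns m ] (falses ε * falses ε + trues ε * trues ε)
                 ≡ ∑[ ε ← allSigns m ] (2 * (falses ε * trues ε)) + m * 2 ^ m
∑-variance zero    = refl
∑-variance (suc m) = begin
  ∑ (allSigns (suc m)) sq
    ≡⟨ ∑-signs-suc m _ ⟩
  ∑[ ε ← ℰ ] (F ε * F ε + suc (T ε) * suc (T ε)) + ∑[ ε ← ℰ ] (suc (F ε) * suc (F ε) + T ε * T ε)
    ≡⟨ ∑-distrib-+ ℰ _ _ ⟨
  ∑[ ε ← ℰ ] ((F ε * F ε + suc (T ε) * suc (T ε)) + (suc (F ε) * suc (F ε) + T ε * T ε))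
    ≡⟨ ∑-cong ℰ (λ ε → eq₁ (F ε) (T ε)) ⟩
  ∑[ ε ← ℰ ] (2 * (F ε * F ε + T ε * T ε) + rest ε)
    ≡⟨ ∑-distrib-+ ℰ _ _ ⟩
  ∑[ ε ← ℰ ] (2 * (F ε * F ε + T ε * T ε)) + ∑ ℰ rest
    ≡⟨ cong (_+ ∑ ℰ rest) (*-distribˡ-∑ 2 ℰ _) ⟨
  2 * ∑[ ε ← ℰ ] (F ε * F ε + T ε * T ε) + ∑ ℰ rest
    ≡⟨ cong (λ x → 2 * x + ∑ ℰ rest) (∑-variance m) ⟩
  2 * (∑[ ε ← ℰ ] (2 * (F ε * T ε)) + m * 2 ^ m) + ∑ ℰ rest
    ≡⟨ cong (2 * (∑[ ε ← ℰ ] (2 * (F ε * T ε)) + m * 2 ^ m) +_)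
         (trans (∑-distrib-+ ℰ _ _) (cong (∑[ ε ← ℰ ] (2 * (F ε + T ε)) +_) (∑-signs-const m 2))) ⟩
  2 * (∑[ ε ← ℰ ] (2 * (F ε * T ε)) + m * 2 ^ m) + (∑[ ε ← ℰ ] (2 * (F ε + T ε)) + 2 ^ m * 2)
    ≡⟨ eq₂ (∑[ ε ← ℰ ] (2 * (F ε * T ε))) m (2 ^ m) (∑[ ε ← ℰ ] (2 * (F ε + T ε))) ⟩
  (2 * ∑[ ε ← ℰ ] (2 * (F ε * T ε)) + ∑[ ε ← ℰ ] (2 * (F ε + T ε))) + suc m * 2 ^ suc m
    ≡⟨ cong (λ x → (x + ∑[ ε ← ℰ ] (2 * (F ε + T ε))) + suc m * 2 ^ suc m) (*-distribˡ-∑ 2 ℰ _) ⟩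
  (∑[ ε ← ℰ ] (2 * (2 * (F ε * T ε))) + ∑[ ε ← ℰ ] (2 * (F ε + T ε))) + suc m * 2 ^ suc m
    ≡⟨ cong (_+ suc m * 2 ^ suc m) (∑-distrib-+ ℰ _ _) ⟨
  ∑[ ε ← ℰ ] (2 * (2 * (F ε * T ε)) + 2 * (F ε + T ε)) + suc m * 2 ^ suc m
    ≡⟨ cong (_+ suc m * 2 ^ suc m) (∑-cong ℰ (λ ε → eq₃ (F ε) (T ε))) ⟩
  ∑[ ε ← ℰ ] (2 * (F ε * suc (T ε)) + 2 * (suc (F ε) * T ε)) + suc m * 2 ^ suc m
    ≡⟨ cong (_+ suc m * 2 ^ suc m) (∑-distrib-+ ℰ _ _) ⟩
  (∑[ ε ← ℰ ] (2 * (F ε * suc (T ε))) + ∑[ ε ← ℰ ] (2 * (suc (F ε) * T ε))) + suc m * 2 ^ suc m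
    ≡⟨ cong (_+ suc m * 2 ^ suc m) (∑-signs-suc m _) ⟨
  ∑[ ε ← allSigns (suc m) ] (2 * (falses ε * trues ε)) + suc m * 2 ^ suc m ∎
  where
  open ≡-Reasoning
  ℰ = allSigns m
  F T rest : Vec Bool m → ℕ
  F = falses
  T = trues
  rest ε = 2 * (F ε + T ε) + 2
  sq : Vec Bool (suc m) → ℕ
  sq ε = falses ε * falses ε + trues ε * trues ε
  eq₁ : ∀ f t → (f * f + suc t * suc t) + (suc f * suc f + t * t) ≡ 2 * (f * f + t * t) + (2 * (f + t) + 2)
  eq₁ = solve-∀
  eq₂ : ∀ a m p b → 2 * (a + m * p) + (b + p * 2) ≡ (2 * a + b) + suc m * (2 * p)
  eq₂ = solve-∀
  eq₃ : ∀ f t → 2 * (2 * (f * t)) + 2 * (f + t) ≡ 2 * (f * suc t) + 2 * (suc f * t)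
  eq₃ = solve-∀

2ab≤a²+b² : ∀ a b → 2 * (a * b) ≤ a * a + b * b
2ab≤a²+b² a b with ≤-total a b
... | inj₁ a≤b with k , refl ← m≤n⇒∃[o]m+o≡n a≤b = m+n≤o⇒m≤o _ (≤-reflexive (eq a k))
  where
  eq : ∀ a k → 2 * (a * (a + k)) + k * k ≡ a * a + (a + k) * (a + k)
  eq = solve-∀
... | inj₂ b≤a with k , refl ← m≤n⇒∃[o]m+o≡n b≤a = m+n≤o⇒m≤o _ (≤-reflexive (eq b k))
  where
  eq : ∀ b k → 2 * ((b + k) * b) + k * k ≡ (b + k) * (b + k) + b * b
  eq = solve-∀

[a∸b]²+2ab≤a²+b² : ∀ a b → (a ∸ b) * (a ∸ b) + 2 * (a * b) ≤ a * a + b * b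
[a∸b]²+2ab≤a²+b² a b with ≤-total a b
... | inj₁ a≤b rewrite m≤n⇒m∸n≡0 a≤b = 2ab≤a²+b² a b
... | inj₂ b≤a with k , refl ← m≤n⇒∃[o]m+o≡n b≤a rewrite m+n∸m≡n b k = ≤-reflexive (eq b k)
  where
  eq : ∀ b k → k * k + 2 * ((b + k) * b) ≡ (b + k) * (b + k) + b * b
  eq = solve-∀

-- In place of Cauchy-Schwarz, 2 s D ≤ s² + D² is averaged, where D is the positive part of F - T:
-- both s² and the mean of D² are at most m.
∑-deviation : ∀ m s → s * s ≤ m → s * ∑[ ε ← allSigns m ] (falses ε ∸ trues ε) ≤ m * 2 ^ m
∑-deviation m s s²≤m = *-cancelˡ-≤ 2 (begin
  2 * (s * ∑ ℰ D)                         ≡⟨ *-assoc 2 s _ ⟨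
  2 * s * ∑ ℰ D                           ≡⟨ *-distribˡ-∑ (2 * s) ℰ D ⟩
  ∑[ ε ← ℰ ] (2 * s * D ε)                ≤⟨ ∑-mono ℰ (λ ε → ≤-trans (≤-reflexive (*-assoc 2 s (D ε))) (2ab≤a²+b² s (D ε))) ⟩
  ∑[ ε ← ℰ ] (s * s + D ε * D ε)          ≡⟨ ∑-distrib-+ ℰ _ _ ⟩
  ∑[ ε ← ℰ ] (s * s) + ∑[ ε ← ℰ ] (D ε * D ε)
    ≤⟨ +-mono-≤ (≤-trans (≤-reflexive (∑-signs-const m _)) (*-monoʳ-≤ (2 ^ m) s²≤m)) second-moment ⟩
  2 ^ m * m + m * 2 ^ m                   ≡⟨ eq (2 ^ m) m ⟩
  2 * (m * 2 ^ m)                         ∎)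
  where
  open ≤-Reasoning
  ℰ = allSigns m
  D : Vec Bool m → ℕ
  D ε = falses ε ∸ trues ε
  eq : ∀ p m → p * m + m * p ≡ 2 * (m * p)
  eq = solve-∀
  second-moment : ∑[ ε ← ℰ ] (D ε * D ε) ≤ m * 2 ^ m
  second-moment = +-cancelʳ-≤ (∑[ ε ← ℰ ] (2 * (falses ε * trues ε))) _ _ (begin
    ∑[ ε ← ℰ ] (D ε * D ε) + ∑[ ε ← ℰ ] (2 * (falses ε * trues ε)) ≡⟨ ∑-distrib-+ ℰ _ _ ⟨
    ∑[ ε ← ℰ ] (D ε * D ε + 2 * (falses ε * trues ε))
      ≤⟨ ∑-mono ℰ (λ ε → [a∸b]²+2ab≤a²+b² (falses ε) (trues ε)) ⟩
    ∑[ ε ← ℰ ] (falses ε * falses ε + trues ε * trues ε)           ≡⟨ ∑-variance m ⟩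
    ∑[ ε ← ℰ ] (2 * (falses ε * trues ε)) + m * 2 ^ m              ≡⟨ +-comm _ (m * 2 ^ m) ⟩
    m * 2 ^ m + ∑[ ε ← ℰ ] (2 * (falses ε * trues ε))              ∎)

-- By the weighted identities, m + 1 times the difference of the two sums of h is the sum of (F - T)
-- h(T) over m + 1 signs. This is at most g times the sum of the positive part of F - T; the 2 comes
-- from 2 ^ (m + 1).
∑-shift-invariance : ∀ m s g (h : ℕ → ℕ) → s * s ≤ suc m → (∀ k → h k ≤ g) →
  s * ∑[ ε ← allSigns m ] h (trues ε) ≤ s * ∑[ ε ← allSigns m ] h (suc (trues ε)) + 2 * g * 2 ^ m
∑-shift-invariance m s g h s²≤ h≤g = *-cancelˡ-≤ (suc m) (begin
  suc m * (s * ∑[ ε ← allSigns m ] h (trues ε))           ≡⟨ x∙yz≡y∙xz (suc m) s _ ⟩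
  s * (suc m * ∑[ ε ← allSigns m ] h (trues ε))           ≡⟨ cong (s *_) (∑-falses-weighted m h) ⟨
  s * ∑[ ε ← ℰ ] (falses ε * h (trues ε))                 ≤⟨ *-monoʳ-≤ s (∑-mono ℰ pointwise) ⟩
  s * ∑[ ε ← ℰ ] (trues ε * h (trues ε) + g * (falses ε ∸ trues ε))
    ≡⟨ cong (s *_) (trans (∑-distrib-+ ℰ _ _) (cong₂ _+_ (∑-trues-weighted m h) (sym (*-distribˡ-∑ g ℰ _)))) ⟩
  s * (suc m * H + g * ∑[ ε ← ℰ ] (falses ε ∸ trues ε))   ≡⟨ eq₁ s (suc m) H g _ ⟩
  suc m * (s * H) + g * (s * ∑[ ε ← ℰ ] (falses ε ∸ trues ε))
    ≤⟨ +-monoʳ-≤ (suc m * (s * H)) (*-monoʳ-≤ g (∑-deviation (suc m) s s²≤)) ⟩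
  suc m * (s * H) + g * (suc m * (2 * 2 ^ m))             ≡⟨ eq₂ (suc m) s H g (2 ^ m) ⟩
  suc m * (s * H + 2 * g * 2 ^ m)                         ∎)
  where
  open ≤-Reasoning
  ℰ = allSigns (suc m)
  H = ∑[ ε ← allSigns m ] h (suc (trues ε))
  x∙yz≡y∙xz : ∀ a b c → a * (b * c) ≡ b * (a * c)
  x∙yz≡y∙xz = solve-∀
  eq₁ : ∀ s n h g d → s * (n * h + g * d) ≡ n * (s * h) + g * (s * d)
  eq₁ = solve-∀
  eq₂ : ∀ n s h g p → n * (s * h) + g * (n * (2 * p)) ≡ n * (s * h + 2 * g * p)
  eq₂ = solve-∀
  pointwise : ∀ ε → falses ε * h (trues ε) ≤ trues ε * h (trues ε) + g * (falses ε ∸ trues ε)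
  pointwise ε = begin
    falses ε * h (trues ε)                                         ≤⟨ *-monoˡ-≤ (h (trues ε)) (m≤n+m∸n (falses ε) (trues ε)) ⟩
    (trues ε + (falses ε ∸ trues ε)) * h (trues ε)                 ≡⟨ *-distribʳ-+ (h (trues ε)) (trues ε) _ ⟩
    trues ε * h (trues ε) + (falses ε ∸ trues ε) * h (trues ε)     ≤⟨ +-monoʳ-≤ _ (*-monoʳ-≤ (falses ε ∸ trues ε) (h≤g (trues ε))) ⟩
    trues ε * h (trues ε) + (falses ε ∸ trues ε) * g               ≡⟨ cong (trues ε * h (trues ε) +_) (*-comm _ g) ⟩
    trues ε * h (trues ε) + g * (falses ε ∸ trues ε)               ∎

-- Advancing by 2 raises the residue by at most 2. If g divides x + 1, the residue of x is g - 1 and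
-- drops to at most 1, a fall that pays for the extra g.
%-sawtooth : ∀ g x .{{_ : NonZero g}} → g * ind (g ∣? suc x) + (2 + x) % g ≤ 2 + x % g
%-sawtooth g x with g ∣? suc x
... | no _ rewrite *-zeroʳ g = begin
  (2 + x) % g             ≡⟨ %-distribˡ-+ 2 x g ⟩
  (2 % g + x % g) % g     ≤⟨ m%n≤m _ g ⟩
  2 % g + x % g           ≤⟨ +-monoˡ-≤ _ (m%n≤m 2 g) ⟩
  2 + x % g               ∎
  where open ≤-Reasoning
... | yes g∣1+x@(divides q 1+x≡qg) = begin
  g * 1 + (2 + x) % g     ≡⟨ cong₂ _+_ (*-identityʳ g) (cong (λ y → (1 + y) % g) 1+x≡qg) ⟩
  g + (1 + q * g) % g     ≡⟨ cong (g +_) ([m+kn]%n≡m%n 1 q g) ⟩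
  g + 1 % g               ≤⟨ +-mono-≤ (∣⇒≤ g∣1+r) (m%n≤m 1 g) ⟩
  suc (x % g) + 1         ≡⟨ +-comm _ 1 ⟩
  2 + x % g               ∎
  where
  open ≤-Reasoning
  g∣1+r : g ∣ suc (x % g)
  g∣1+r = ∣m+n∣m⇒∣n {m = x / g * g}
    (subst (g ∣_) (trans (cong suc (m≡m%n+[m/n]*n x g)) (+-comm _ (x / g * g))) g∣1+x) (n∣m*n (x / g))

-- Telescoping the sawtooth h k = (2k + c) mod g, which jumps exactly on the residue class in question,
-- reduces its density to the near shift invariance of the binomial distribution.
binomial-equidistribution : ∀ m s g c .{{_ : NonZero g}} → s * s ≤ suc m →
  g * s * ∑[ ε ← allSigns m ] ind (g ∣? suc (2 * trues ε + c)) ≤ 2 * (s + g) * 2 ^ m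
binomial-equidistribution m s g c s²≤ = +-cancelʳ-≤ (s * ∑[ ε ← ℰ ] h (suc (trues ε))) _ _ (begin
  g * s * ∑ ℰ I + s * H₁            ≡⟨ eq₁ g s (∑ ℰ I) H₁ ⟩
  s * (g * ∑ ℰ I + H₁)              ≡⟨ cong (λ x → s * (x + H₁)) (*-distribˡ-∑ g ℰ I) ⟩
  s * (∑[ ε ← ℰ ] (g * I ε) + H₁)   ≡⟨ cong (s *_) (∑-distrib-+ ℰ _ _) ⟨
  s * ∑[ ε ← ℰ ] (g * I ε + h (suc (trues ε)))
                                    ≤⟨ *-monoʳ-≤ s (∑-mono ℰ λ ε → pointwise (trues ε)) ⟩
  s * ∑[ ε ← ℰ ] (2 + h (trues ε))  ≡⟨ cong (s *_) (trans (∑-distrib-+ ℰ _ _) (cong (_+ H₀) (∑-signs-const m 2))) ⟩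
  s * (2 ^ m * 2 + H₀)              ≡⟨ *-distribˡ-+ s _ H₀ ⟩
  s * (2 ^ m * 2) + s * H₀          ≤⟨ +-monoʳ-≤ (s * (2 ^ m * 2)) (∑-shift-invariance m s g h s²≤ λ k → m%n≤n _ g) ⟩
  s * (2 ^ m * 2) + (s * H₁ + 2 * g * 2 ^ m) ≡⟨ eq₂ s (2 ^ m) H₁ g ⟩
  2 * (s + g) * 2 ^ m + s * H₁      ∎)
  where
  open ≤-Reasoning
  ℰ = allSigns m
  h : ℕ → ℕ
  h k = (2 * k + c) % g
  I : Vec Bool m → ℕ
  I ε = ind (g ∣? suc (2 * trues ε + c))
  H₀ H₁ : ℕ
  H₀ = ∑[ ε ← ℰ ] h (trues ε)
  H₁ = ∑[ ε ← ℰ ] h (suc (trues ε))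
  eq₁ : ∀ g s i h → g * s * i + s * h ≡ s * (g * i + h)
  eq₁ = solve-∀
  eq₂ : ∀ s p h g → s * (p * 2) + (s * h + 2 * g * p) ≡ 2 * (s + g) * p + s * h
  eq₂ = solve-∀
  eq₃ : ∀ k c → 2 * suc k + c ≡ 2 + (2 * k + c)
  eq₃ = solve-∀
  pointwise : ∀ k → g * ind (g ∣? suc (2 * k + c)) + h (suc k) ≤ 2 + h k
  pointwise k rewrite eq₃ k c = %-sawtooth g (2 * k + c)

-- Averages of the greatest common divisor

gcd-nonZero : ∀ u v .{{_ : NonZero u}} → NonZero (gcd u v)
gcd-nonZero u v = ≢-nonZero (gcd[m,n]≢0 u v (inj₁ (≢-nonZero⁻¹ u)))

sqrt : ∀ u → ∃ λ s → s * s ≤ u × u < suc s * suc s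
sqrt zero = 0 , z≤n , z<s
sqrt (suc u) with sqrt u
... | s , s²≤u , u<t² with suc u <? suc s * suc s
...   | yes 1+u<t² = s , m≤n⇒m≤1+n s²≤u , 1+u<t²
...   | no  1+u≮t² = suc s , ≮⇒≥ 1+u≮t² , ≤-<-trans u<t² (*-mono-< (n<1+n (suc s)) (n<1+n (suc s)))

-- Of a divisor and its cofactor at least one is at most s, and each cofactor belongs to a single
-- divisor; hence s small and at most s large divisors.
∑-divisors : ∀ u s .{{_ : NonZero u}} → u < suc s * suc s → ∑[ g ← upTo u ] ind (suc g ∣? u) ≤ 2 * s
∑-divisors u s u<t² = begin
  ∑[ g ← upTo u ] ind (suc g ∣? u)
    ≤⟨ ∑-mono (upTo u) small-or-large ⟩
  ∑[ g ← upTo u ] (ind (suc g ≤? s) + ∑[ q ← upTo s ] ind (suc g * suc q ≟ u))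
    ≡⟨ ∑-distrib-+ (upTo u) _ _ ⟩
  ∑[ g ← upTo u ] ind (suc g ≤? s) + ∑[ g ← upTo u ] ∑[ q ← upTo s ] ind (suc g * suc q ≟ u)
    ≡⟨ cong (∑[ g ← upTo u ] ind (suc g ≤? s) +_) (∑-swap (upTo u) (upTo s) _) ⟩
  ∑[ g ← upTo u ] ind (suc g ≤? s) + ∑[ q ← upTo s ] ∑[ g ← upTo u ] ind (suc g * suc q ≟ u)
    ≤⟨ +-mono-≤ (∑-upTo-truncate u s _ λ g s≤g → ind-no (suc g ≤? s) (<⇒≱ (s≤s s≤g)))
                (∑-mono (upTo s) λ q → ∑-unique u (λ g → suc g * suc q ≟ u) (unique q)) ⟩
  ∑[ g ← upTo s ] ind (suc g ≤? s) + ∑[ q ← upTo s ] 1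
    ≤⟨ +-monoˡ-≤ _ (∑-mono (upTo s) λ g → ind≤1 (suc g ≤? s)) ⟩
  ∑[ g ← upTo s ] 1 + ∑[ q ← upTo s ] 1
    ≡⟨ cong₂ _+_ (∑-upTo-const s 1) (∑-upTo-const s 1) ⟩
  s * 1 + s * 1
    ≡⟨ eq s ⟩
  2 * s ∎
  where
  open ≤-Reasoning
  eq : ∀ s → s * 1 + s * 1 ≡ 2 * s
  eq = solve-∀
  unique : ∀ q i j → suc i * suc q ≡ u → suc j * suc q ≡ u → i ≡ j
  unique q i j p r = suc-injective (*-cancelʳ-≡ (suc i) (suc j) (suc q) (trans p (sym r)))
  small-or-large : ∀ g → ind (suc g ∣? u) ≤ ind (suc g ≤? s) + ∑[ q ← upTo s ] ind (suc g * suc q ≟ u)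
  small-or-large g with suc g ∣? u | suc g ≤? s
  ... | no _  | _       = z≤n
  ... | yes _ | yes g≤s = m≤m+n 1 _
  ... | yes (divides zero u≡0)     | no _   = contradiction u≡0 (≢-nonZero⁻¹ u)
  ... | yes (divides (suc q) u≡qg) | no g≰s = begin
    1                                          ≤⟨ ind-mono (yes u≡qg) (suc g * suc q ≟ u) (λ eq → trans (*-comm (suc g) (suc q)) (sym eq)) ⟩
    ind (suc g * suc q ≟ u)                    ≤⟨ term≤∑ (λ q → ind (suc g * suc q ≟ u)) (∈-upTo⁺ q<s) ⟩
    ∑[ q ← upTo s ] ind (suc g * suc q ≟ u)    ∎
    where
    q<s : q < s
    q<s = ≰⇒> λ s≤q → <⇒≱ u<t² (subst (suc s * suc s ≤_) (sym u≡qg) (*-mono-≤ (s≤s s≤q) (≰⇒> g≰s)))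

-- The gcd is at most the sum of all common divisors. A divisor g of u has weight g at each of its
-- multiples up to u, in total at most u + g ≤ 2 u by the spacing bound; there are at most 2 s
-- divisors.
∑-gcd : ∀ u s .{{_ : NonZero u}} → u < suc s * suc s → ∑[ v ← upTo u ] gcd u (suc v) ≤ 4 * (u * s)
∑-gcd u s u<t² = begin
  ∑[ v ← upTo u ] gcd u (suc v)
    ≤⟨ ∑-mono (upTo u) gcd≤∑ ⟩
  ∑[ v ← upTo u ] ∑[ g ← upTo u ] (ind (suc g ∣? u) * (suc g * ind (suc g ∣? suc v)))
    ≡⟨ ∑-swap (upTo u) (upTo u) _ ⟩
  ∑[ g ← upTo u ] ∑[ v ← upTo u ] (ind (suc g ∣? u) * (suc g * ind (suc g ∣? suc v)))
    ≤⟨ ∑-mono-∈ (upTo u) (λ g g∈ → multiples g (∈-upTo⁻ g∈)) ⟩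
  ∑[ g ← upTo u ] (2 * u * ind (suc g ∣? u))
    ≡⟨ *-distribˡ-∑ (2 * u) (upTo u) _ ⟨
  2 * u * ∑[ g ← upTo u ] ind (suc g ∣? u)
    ≤⟨ *-monoʳ-≤ (2 * u) (∑-divisors u s u<t²) ⟩
  2 * u * (2 * s)
    ≡⟨ eq₁ u s ⟩
  4 * (u * s) ∎
  where
  open ≤-Reasoning
  eq₁ : ∀ u s → 2 * u * (2 * s) ≡ 4 * (u * s)
  eq₁ = solve-∀
  eq₂ : ∀ i u → i * (1 * u + u) ≡ 2 * u * i
  eq₂ = solve-∀
  term : ℕ → ℕ → ℕ
  term v g = ind (suc g ∣? u) * (suc g * ind (suc g ∣? suc v))
  gcd≤∑ : ∀ v → gcd u (suc v) ≤ ∑[ g ← upTo u ] term v g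
  gcd≤∑ v with gcd u (suc v) | gcd[m,n]∣m u (suc v) | gcd[m,n]∣n u (suc v)
  ... | zero  | _   | _   = z≤n
  ... | suc g | g∣u | g∣v = begin
    suc g                        ≡⟨ trans (*-identityˡ _) (*-identityʳ (suc g)) ⟨
    1 * (suc g * 1)              ≤⟨ *-mono-≤ (ind-mono (yes g∣u) (suc g ∣? u) λ d → d)
                                      (*-monoʳ-≤ (suc g) (ind-mono (yes g∣v) (suc g ∣? suc v) λ d → d)) ⟩
    term v g                     ≤⟨ term≤∑ (term v) (∈-upTo⁺ (∣⇒≤ g∣u)) ⟩
    ∑ (upTo u) (term v)          ∎
  spaced : ∀ g b c → 0 < ind (suc g ∣? suc b) → 0 < ind (suc g ∣? suc c) → b < c → suc g + 1 * b ≤ 1 * c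
  spaced g b c p q b<c with k , refl ← m≤n⇒∃[o]m+o≡n b<c = begin
    suc g + 1 * b    ≤⟨ +-monoˡ-≤ (1 * b) (∣⇒≤ g∣1+k) ⟩
    suc k + 1 * b    ≡⟨ eq b k ⟩
    1 * (suc b + k)  ∎
    where
    eq : ∀ b k → suc k + 1 * b ≡ 1 * (suc b + k)
    eq = solve-∀
    g∣1+k : suc g ∣ suc k
    g∣1+k = ∣m+n∣m⇒∣n (subst (suc g ∣_) (sym (+-suc (suc b) k)) (ind-positive⁻ (suc g ∣? suc (suc b + k)) q))
                       (ind-positive⁻ (suc g ∣? suc b) p)
  multiples : ∀ g → g < u → ∑[ v ← upTo u ] term v g ≤ 2 * u * ind (suc g ∣? u)
  multiples g g<u = begin
    ∑[ v ← upTo u ] term v g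
      ≡⟨ *-distribˡ-∑ (ind (suc g ∣? u)) (upTo u) _ ⟨
    ind (suc g ∣? u) * ∑[ v ← upTo u ] (suc g * ind (suc g ∣? suc v))
      ≡⟨ cong (ind (suc g ∣? u) *_) (*-distribˡ-∑ (suc g) (upTo u) _) ⟨
    ind (suc g ∣? u) * (suc g * ∑[ v ← upTo u ] ind (suc g ∣? suc v))
      ≤⟨ *-monoʳ-≤ (ind (suc g ∣? u)) (∑-spaced (suc g) 1 _ (λ v → ind≤1 (suc g ∣? suc v)) (spaced g) u) ⟩
    ind (suc g ∣? u) * (1 * u + suc g)
      ≤⟨ *-monoʳ-≤ (ind (suc g ∣? u)) (+-monoʳ-≤ (1 * u) g<u) ⟩
    ind (suc g ∣? u) * (1 * u + u)
      ≡⟨ eq₂ (ind (suc g ∣? u)) u ⟩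
    2 * u * ind (suc g ∣? u) ∎

-- Solutions of 3 v b + y = 3 u d + x + 2 k

module _ (u v : ℕ) .{{_ : NonZero u}} (x y : ℕ) where

  private
    g : ℕ
    g = gcd u v
    instance
      g≢0 : NonZero g
      g≢0 = gcd-nonZero u v

  -- In the application d and b are the starting indices of the two blocks, k is the binomial
  -- variable, and x and y are `tri u` and `tri v + 2 * v`.
  Solution : ℕ → ℕ → ℕ → Set
  Solution k b d = 3 * (v * b) + y ≡ 3 * (u * d) + x + 2 * k

  solution? : ∀ k b d → Dec (Solution k b d)
  solution? k b d = 3 * (v * b) + y ≟ 3 * (u * d) + x + 2 * k

  solution-unique : ∀ k b d e → Solution k b d → Solution k b e → d ≡ e
  solution-unique k b d e p q = *-cancelˡ-≡ d e u (*-cancelˡ-≡ (u * d) (u * e) 3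
    (+-cancelʳ-≡ x _ _ (+-cancelʳ-≡ (2 * k) _ _ (trans (sym p) q))))

  -- Subtracting the two equations gives u (e - d) = v (c - b). So u divides both (c - b) u and (c -
  -- b) v, hence their gcd (c - b) g, and therefore u ≤ (c - b) g.
  solution-spaced : ∀ k b c d e → Solution k b d → Solution k c e → b < c → u + g * b ≤ g * c
  solution-spaced k b c d e p q b<c with o , refl ← m≤n⇒∃[o]m+o≡n b<c = begin
    u + g * b               ≤⟨ +-monoˡ-≤ (g * b) (∣⇒≤ {{m*n≢0 (suc o) g}} u∣og) ⟩
    suc o * g + g * b       ≡⟨ eq₂ g b o ⟩
    g * (suc b + o)         ∎
    where
    open ≤-Reasoning
    eq₁ : ∀ v b o y → 3 * (v * (suc b + o)) + y ≡ 3 * (v * b) + y + 3 * (v * suc o)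
    eq₁ = solve-∀
    eq₂ : ∀ g b o → suc o * g + g * b ≡ g * (suc b + o)
    eq₂ = solve-∀
    eq₃ : ∀ u d x k w → 3 * (u * d) + x + 2 * k + 3 * w ≡ 3 * (u * d + w) + (x + 2 * k)
    eq₃ = solve-∀
    ue≡ud+vo : u * e ≡ u * d + v * suc o
    ue≡ud+vo = *-cancelˡ-≡ _ _ 3 (+-cancelʳ-≡ (x + 2 * k) _ _ (begin-equality
      3 * (u * e) + (x + 2 * k)                 ≡⟨ +-assoc (3 * (u * e)) x (2 * k) ⟨
      3 * (u * e) + x + 2 * k                   ≡⟨ q ⟨
      3 * (v * (suc b + o)) + y                 ≡⟨ eq₁ v b o y ⟩
      3 * (v * b) + y + 3 * (v * suc o)         ≡⟨ cong (_+ 3 * (v * suc o)) p ⟩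
      3 * (u * d) + x + 2 * k + 3 * (v * suc o) ≡⟨ eq₃ u d x k (v * suc o) ⟩
      3 * (u * d + v * suc o) + (x + 2 * k)     ∎))
    u∣vo : u ∣ suc o * v
    u∣vo = subst (u ∣_) (*-comm v (suc o)) (∣m+n∣m⇒∣n (subst (u ∣_) ue≡ud+vo (m∣m*n e)) (m∣m*n d))
    u∣og : u ∣ suc o * g
    u∣og = subst (u ∣_) (sym (c*gcd[m,n]≡gcd[cm,cn] (suc o) u v)) (gcd-greatest (n∣m*n (suc o)) u∣vo)

  -- Modulo g the equation says 2 k + x - y ≡ 0. Here `pred g * y` stands for -y, and the last
  -- `pred g` offsets the `suc` in the divisibility condition of `binomial-equidistribution`.
  residue : ℕ
  residue = x + pred g * y + pred g

  solution-residue : ∀ k b d → Solution k b d → g ∣ suc (2 * k + residue)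
  solution-residue k b d p = ∣m+n∣m⇒∣n (subst (g ∣_) (sym total) (∣m∣n⇒∣m+n g∣3vb (m∣m*n (suc y)))) g∣3ud
    where
    open ≡-Reasoning
    g∣3vb : g ∣ 3 * (v * b)
    g∣3vb = ∣n⇒∣m*n 3 (∣m⇒∣m*n b (gcd[m,n]∣n u v))
    g∣3ud : g ∣ 3 * (u * d)
    g∣3ud = ∣n⇒∣m*n 3 (∣m⇒∣m*n d (gcd[m,n]∣m u v))
    eq₁ : ∀ w x k p y → w + suc (2 * k + (x + p * y + p)) ≡ (w + x + 2 * k) + (p * y + suc p)
    eq₁ = solve-∀
    eq₂ : ∀ w p y → (w + y) + (p * y + suc p) ≡ w + suc p * suc y
    eq₂ = solve-∀
    total : 3 * (u * d) + suc (2 * k + residue) ≡ 3 * (v * b) + g * suc y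
    total = begin
      3 * (u * d) + suc (2 * k + residue)                         ≡⟨ eq₁ (3 * (u * d)) x k (pred g) y ⟩
      (3 * (u * d) + x + 2 * k) + (pred g * y + suc (pred g))     ≡⟨ cong (_+ (pred g * y + suc (pred g))) p ⟨
      (3 * (v * b) + y) + (pred g * y + suc (pred g))             ≡⟨ eq₂ (3 * (v * b)) (pred g) y ⟩
      3 * (v * b) + suc (pred g) * suc y                          ≡⟨ cong (λ z → 3 * (v * b) + z * suc y) (suc-pred g) ⟩
      3 * (v * b) + g * suc y                                     ∎

  ∑-solutions : ∀ n k → u * ∑[ b ← upTo n ] ∑[ d ← upTo n ] ind (solution? k b d)
                      ≤ (g * n + u) * ind (g ∣? suc (2 * k + residue))
  ∑-solutions n k with g ∣? suc (2 * k + residue)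
  ... | yes _ rewrite *-identityʳ (g * n + u) =
    ∑-spaced u g _ (λ b → ∑-unique n (solution? k b) (solution-unique k b)) spaced n
    where
    spaced : ∀ b c → 0 < ∑[ d ← upTo n ] ind (solution? k b d) →
             0 < ∑[ d ← upTo n ] ind (solution? k c d) → b < c → u + g * b ≤ g * c
    spaced b c 0<b 0<c b<c =
      let d , 0<d = ∑-positive⁻ (upTo n) _ 0<b
          e , 0<e = ∑-positive⁻ (upTo n) _ 0<c
      in solution-spaced k b c d e (ind-positive⁻ (solution? k b d) 0<d) (ind-positive⁻ (solution? k c e) 0<e) b<c
  ... | no g∤
    rewrite ∑-zero (upTo n) (λ b → ∑-zero (upTo n) λ d → ind-no (solution? k b d) (λ p → g∤ (solution-residue k b d p)))
          | *-zeroʳ u = z≤n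

  expected-solutions : ∀ n m s .{{_ : NonZero s}} → s * s ≤ suc m →
    u * s * ∑[ ε ← allSigns m ] ∑[ b ← upTo n ] ∑[ d ← upTo n ] ind (solution? (trues ε) b d)
    ≤ (4 * (u * s) + 2 * n * (s + g)) * 2 ^ m
  expected-solutions n m s s²≤ = *-cancelˡ-≤ g (begin
    g * (u * s * ∑ ℰ X)               ≡⟨ eq₁ g u s (∑ ℰ X) ⟩
    g * s * (u * ∑ ℰ X)               ≡⟨ cong (g * s *_) (*-distribˡ-∑ u ℰ X) ⟩
    g * s * ∑[ ε ← ℰ ] (u * X ε)      ≤⟨ *-monoʳ-≤ (g * s) (∑-mono ℰ λ ε → ∑-solutions n (trues ε)) ⟩
    g * s * ∑[ ε ← ℰ ] ((g * n + u) * I ε) ≡⟨ cong (g * s *_) (*-distribˡ-∑ (g * n + u) ℰ I) ⟨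
    g * s * ((g * n + u) * ∑ ℰ I)     ≡⟨ eq₂ (g * s) (g * n + u) (∑ ℰ I) ⟩
    (g * n + u) * (g * s * ∑ ℰ I)     ≤⟨ *-monoʳ-≤ (g * n + u) (binomial-equidistribution m s g residue s²≤) ⟩
    (g * n + u) * (2 * (s + g) * 2 ^ m) ≡⟨ eq₃ g n u s (2 ^ m) ⟩
    (g * (2 * n * (s + g)) + 2 * u * (s + g)) * 2 ^ m
      -- Since s and g are positive, s + g ≤ 2 s g. This makes the second term a multiple of g, so
      -- that g can be cancelled, and yields the 4 u s.
      ≤⟨ *-monoˡ-≤ (2 ^ m) (+-monoʳ-≤ (g * (2 * n * (s + g))) (*-monoʳ-≤ (2 * u)
           (+-mono-≤ (m≤m*n s g) (m≤n*m g s)))) ⟩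
    (g * (2 * n * (s + g)) + 2 * u * (s * g + s * g)) * 2 ^ m ≡⟨ eq₄ g n u s (2 ^ m) ⟩
    g * ((4 * (u * s) + 2 * n * (s + g)) * 2 ^ m) ∎)
    where
    open ≤-Reasoning
    ℰ = allSigns m
    X = λ ε → ∑[ b ← upTo n ] ∑[ d ← upTo n ] ind (solution? (trues ε) b d)
    I = λ ε → ind (g ∣? suc (2 * trues ε + residue))
    eq₁ : ∀ g u s x → g * (u * s * x) ≡ g * s * (u * x)
    eq₁ = solve-∀
    eq₂ : ∀ a b c → a * (b * c) ≡ b * (a * c)
    eq₂ = solve-∀
    eq₃ : ∀ g n u s p → (g * n + u) * (2 * (s + g) * p) ≡ (g * (2 * n * (s + g)) + 2 * u * (s + g)) * p
    eq₃ = solve-∀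
    eq₄ : ∀ g n u s p → (g * (2 * n * (s + g)) + 2 * u * (s * g + s * g)) * p ≡ g * ((4 * (u * s) + 2 * n * (s + g)) * p)
    eq₄ = solve-∀

-- The points p₀ < … < pₙ as natural numbers

-- With 0-based i, 3 (i + 1) ± 1 is 3 i + 2 or 3 i + 4.
step : ℕ → Bool → ℕ
step i b = 2 + 3 * i + 2 * trues (b ∷ [])

-- The first argument counts the steps already taken, the second is the value reached. Past the end
-- the last point is repeated, so that no index bound has to be carried.
point : ∀ {n} → ℕ → ℕ → Vec Bool n → ℕ → ℕ
point i s ε       zero    = s
point i s []      (suc k) = s
point i s (b ∷ ε) (suc k) = point (suc i) (s + step i b) ε k

aTerm≡step : ∀ i b → aTerm (suc i) b ≡ ℤ.+ step i b
aTerm≡step i true  = cong ℤ.+_ (eq i)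
  where
  eq : ∀ i → 3 * suc i + 1 ≡ 2 + 3 * i + 2 * 1
  eq = solve-∀
aTerm≡step i false = cong (ℤ.+_ ∘ pred) (eq i)
  where
  eq : ∀ i → 3 * suc i ≡ suc (2 + 3 * i + 2 * 0)
  eq = solve-∀

psums≡points : ∀ {n} i s (ε : Vec Bool n) → psums (suc i) (ℤ.+ s) ε ≡ map (ℤ.+_ ∘ point i s ε) (upTo (suc n))
psums≡points i s []      = refl
psums≡points {suc n} i s (b ∷ ε) = cong (ℤ.+ s ∷_) (begin
  psums (2 + i) (ℤ.+ s ℤ.+ aTerm (suc i) b) ε             ≡⟨ cong (λ a → psums (2 + i) (ℤ.+ s ℤ.+ a) ε) (aTerm≡step i b) ⟩
  psums (2 + i) (ℤ.+ (s + step i b)) ε                    ≡⟨ psums≡points (suc i) _ ε ⟩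
  map (ℤ.+_ ∘ point (suc i) (s + step i b) ε) (upTo (suc n)) ≡⟨ map-upTo _ (suc n) ⟩
  _                                                     ≡⟨ shift (ℤ.+_ ∘ point i s (b ∷ ε)) (suc n) ⟩
  _                                                     ∎)
  where
  open ≡-Reasoning
  shift : ∀ (f : ℕ → ℤ) n → applyUpTo (f ∘ suc) n ≡ map f (applyUpTo suc n)
  shift f n = sym (map-applyUpTo suc f n)

point-≤ : ∀ {n} i s (ε : Vec Bool n) k → s ≤ point i s ε k
point-≤ i s ε       zero    = ≤-refl
point-≤ i s []      (suc k) = ≤-refl
point-≤ i s (b ∷ ε) (suc k) = ≤-trans (m≤m+n s _) (point-≤ (suc i) (s + step i b) ε k)

point-strictMono : ∀ {n} i s (ε : Vec Bool n) {j k} → j < k → k ≤ n → point i s ε j < point i s ε k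
point-strictMono i s (b ∷ ε) {zero}  {suc k} _   _   =
  <-≤-trans (m<m+n s z<s) (point-≤ (suc i) (s + step i b) ε k)
point-strictMono i s (b ∷ ε) {suc j} {suc k} j<k k≤n =
  point-strictMono (suc i) (s + step i b) ε (s<s⁻¹ j<k) (s≤s⁻¹ k≤n)

point-++ : ∀ {m n} i s (α : Vec Bool m) (β : Vec Bool n) k →
           point i s (α ++ β) (m + k) ≡ point (i + m) (point i s α m) β k
point-++ i s []      β k rewrite +-identityʳ i = refl
point-++ {suc m} i s (b ∷ α) β k rewrite +-suc i m = point-++ (suc i) (s + step i b) α β k

point-++ˡ : ∀ {m n} i s (α : Vec Bool m) (β : Vec Bool n) → point i s (α ++ β) m ≡ point i s α m
point-++ˡ i s []      β = refl
point-++ˡ i s (b ∷ α) β = point-++ˡ (suc i) (s + step i b) α β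

-- The sum of the first m steps when all signs are negative.
tri : ℕ → ℕ
tri zero    = 0
tri (suc m) = 2 + 3 * m + tri m

tri-mono : ∀ {m n} → m ≤ n → tri m ≤ tri n
tri-mono z≤n       = z≤n
tri-mono (s≤s m≤n) = +-mono-≤ (+-monoʳ-≤ 2 (*-monoʳ-≤ 3 m≤n)) (tri-mono m≤n)

-- Starting a block at index i instead of 0 adds 3 i to each of its m steps, and each `true` adds 2
-- to the least possible step.
point-end : ∀ {m} i s (α : Vec Bool m) → point i s α m ≡ s + (3 * (m * i) + tri m + 2 * trues α)
point-end i s [] = sym (+-identityʳ s)
point-end {suc m} i s (b ∷ α) = begin
  point (suc i) (s + step i b) α m                                                        ≡⟨ point-end (suc i) _ α ⟩
  s + step i b + (3 * (m * suc i) + tri m + 2 * trues α)                                  ≡⟨ eq s i m (tri m) (trues (b ∷ [])) (trues α) ⟩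
  s + (3 * (suc m * i) + tri (suc m) + 2 * (trues (b ∷ []) + trues α))                    ≡⟨ cong (λ t → s + (3 * (suc m * i) + tri (suc m) + 2 * t)) (trues-++ (b ∷ []) α) ⟨
  s + (3 * (suc m * i) + tri (suc m) + 2 * trues (b ∷ α))                                 ∎
  where
  open ≡-Reasoning
  eq : ∀ s i m t x y → s + (2 + 3 * i + 2 * x) + (3 * (m * suc i) + t + 2 * y)
                     ≡ s + (3 * (suc m * i) + (2 + 3 * m + t) + 2 * (x + y))
  eq = solve-∀

-- Coincidences between the sums over two disjoint blocks of steps

module _ (d u w v r : ℕ) where

  private
    b = d + u + w

  -- The sign vector is cut into five pieces: before the first block, the block, the gap, the second
  -- block, the rest. Only `α` and `β` survive, because the values at the two starting points
  -- cancel.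
  block-equation : ∀ (δ : Vec Bool d) (α : Vec Bool u) (ω : Vec Bool w) (β : Vec Bool v) (ρ : Vec Bool r) →
    let p = point 0 0 (δ ++ (α ++ (ω ++ (β ++ ρ)))) in
    p (b + v) + p d ≡ p (d + u) + p b →
    3 * (v * b) + tri v + 2 * trues β ≡ 3 * (u * d) + tri u + 2 * trues α
  block-equation δ α ω β ρ eq
    rewrite +-assoc (d + u) w v | +-assoc d u (w + v) | +-assoc d u w
          | point-++ 0 0 δ (α ++ (ω ++ (β ++ ρ))) (u + (w + v))
          | point-++ 0 0 δ (α ++ (ω ++ (β ++ ρ))) (u + w)
          | point-++ 0 0 δ (α ++ (ω ++ (β ++ ρ))) u
          | point-++ˡ 0 0 δ (α ++ (ω ++ (β ++ ρ)))
    -- `x₁` and `x₃` are the points at d and at b, and `x₂` is the sum over the first block. With V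
    -- the sum over the second, the hypothesis turns into x₃ + V + x₁ = x₁ + x₂ + x₃.
    with x₁ ← point 0 0 δ d
    rewrite point-++ d x₁ α (ω ++ (β ++ ρ)) (w + v)
          | point-++ d x₁ α (ω ++ (β ++ ρ)) w
          | point-++ˡ d x₁ α (ω ++ (β ++ ρ))
          | point-end d x₁ α
    with x₂ ← 3 * (u * d) + tri u + 2 * trues α
    rewrite point-++ (d + u) (x₁ + x₂) ω (β ++ ρ) v
          | point-++ˡ (d + u) (x₁ + x₂) ω (β ++ ρ)
    with x₃ ← point (d + u) (x₁ + x₂) ω w
    rewrite point-++ˡ (d + u + w) x₃ β ρ
          | point-end (d + u + w) x₃ β
          | +-assoc d u w
    = +-cancelˡ-≡ (x₃ + x₁) _ _ (trans (move₁ x₃ _ x₁) (trans eq (move₂ x₁ x₂ x₃)))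
    where
    move₁ : ∀ a b c → a + c + b ≡ a + b + c
    move₁ = solve-∀
    move₂ : ∀ a b c → a + b + c ≡ c + a + b
    move₂ = solve-∀

  -- Reversing the signs of the second block turns the difference of the two sign sums into a single binomial variable.
  block-solution : .{{_ : NonZero u}} (α : Vec Bool u) (β : Vec Bool v) →
    3 * (v * b) + tri v + 2 * trues β ≡ 3 * (u * d) + tri u + 2 * trues α →
    Solution u v (tri u) (tri v + 2 * v) (trues α + falses β) b d
  block-solution α β eq = begin
    3 * (v * b) + (tri v + 2 * v)                          ≡⟨ cong (λ x → 3 * (v * b) + (tri v + 2 * x)) (trues+falses β) ⟨
    3 * (v * b) + (tri v + 2 * (trues β + falses β))       ≡⟨ move (3 * (v * b)) (tri v) (trues β) (falses β) ⟩
    3 * (v * b) + tri v + 2 * trues β + 2 * falses β       ≡⟨ cong (_+ 2 * falses β) eq ⟩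
    3 * (u * d) + tri u + 2 * trues α + 2 * falses β       ≡⟨ +-assoc (3 * (u * d) + tri u) _ _ ⟩
    3 * (u * d) + tri u + (2 * trues α + 2 * falses β)     ≡⟨ cong (3 * (u * d) + tri u +_) (*-distribˡ-+ 2 (trues α) (falses β)) ⟨
    3 * (u * d) + tri u + 2 * (trues α + falses β)         ∎
    where
    open ≡-Reasoning
    move : ∀ a t x y → a + (t + 2 * (x + y)) ≡ a + t + 2 * x + 2 * y
    move = solve-∀

  -- The second block starts at least u indices later, so if it were no shorter it would gain 3 u² ≥
  -- 3 u over the first, more than the 2 u that signs can make up.
  block-length : .{{_ : NonZero u}} (α : Vec Bool u) (β : Vec Bool v) →
    3 * (v * b) + tri v + 2 * trues β ≡ 3 * (u * d) + tri u + 2 * trues α → v < u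
  block-length α β eq = ≰⇒> λ u≤v → <⇒≢ (begin-strict
    3 * (u * d) + tri u + 2 * trues α       ≤⟨ +-monoʳ-≤ (3 * (u * d) + tri u) (*-monoʳ-≤ 2 trues≤u) ⟩
    3 * (u * d) + tri u + 2 * u             <⟨ +-monoʳ-< (3 * (u * d) + tri u) (*-monoˡ-< u (n<1+n 2)) ⟩
    3 * (u * d) + tri u + 3 * u             ≤⟨ +-monoʳ-≤ (3 * (u * d) + tri u) (*-monoʳ-≤ 3 (m≤m*n u u)) ⟩
    3 * (u * d) + tri u + 3 * (u * u)       ≡⟨ move u d (tri u) ⟩
    3 * (u * (d + u)) + tri u               ≤⟨ +-mono-≤ (*-monoʳ-≤ 3 (*-mono-≤ u≤v (m≤m+n (d + u) w))) (tri-mono u≤v) ⟩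
    3 * (v * b) + tri v                     ≤⟨ m≤m+n _ _ ⟩
    3 * (v * b) + tri v + 2 * trues β       ∎) (sym eq)
    where
    open ≤-Reasoning
    move : ∀ u d t → 3 * (u * d) + t + 3 * (u * u) ≡ 3 * (u * (d + u)) + t
    move = solve-∀
    trues≤u : trues α ≤ u
    trues≤u = m+n≤o⇒m≤o (trues α) (≤-reflexive (trues+falses α))

  -- After division by both powers of 2 this compares an average over all signs with one over the
  -- signs of the two blocks; the other three pieces average out.
  ∑-blocks : (F : Vec Bool (d + (u + (w + (v + r)))) → ℕ) (φ : ℕ → ℕ) →
    (∀ δ α ω β ρ → F (δ ++ (α ++ (ω ++ (β ++ ρ)))) ≤ φ (trues α + falses β)) →
    2 ^ (u + v) * ∑ (allSigns (d + (u + (w + (v + r))))) F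
      ≤ 2 ^ (d + (u + (w + (v + r)))) * ∑[ ε ← allSigns (u + v) ] φ (trues ε)
  ∑-blocks F φ F≤φ = begin
    2 ^ (u + v) * ∑ (allSigns (d + (u + (w + (v + r))))) F
      ≡⟨ cong (2 ^ (u + v) *_) split ⟩
    2 ^ (u + v) * ∑[ δ ← allSigns d ] ∑[ α ← allSigns u ] ∑[ ω ← allSigns w ] ∑[ β ← allSigns v ] ∑[ ρ ← allSigns r ] F (δ ++ (α ++ (ω ++ (β ++ ρ))))
      ≤⟨ *-monoʳ-≤ (2 ^ (u + v)) (∑-mono (allSigns d) λ δ → ∑-mono (allSigns u) λ α → ∑-mono (allSigns w) λ ω →
           ∑-mono (allSigns v) λ β → ∑-mono (allSigns r) λ ρ → F≤φ δ α ω β ρ) ⟩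
    2 ^ (u + v) * ∑[ δ ← allSigns d ] ∑[ α ← allSigns u ] ∑[ ω ← allSigns w ] ∑[ β ← allSigns v ] ∑[ ρ ← allSigns r ] φ (trues α + falses β)
      ≡⟨ cong (2 ^ (u + v) *_) collect ⟩
    2 ^ (u + v) * (2 ^ d * (2 ^ w * (2 ^ r * Φ)))
      ≡⟨ cong (_* (2 ^ d * (2 ^ w * (2 ^ r * Φ)))) (^-distribˡ-+-* 2 u v) ⟩
    2 ^ u * 2 ^ v * (2 ^ d * (2 ^ w * (2 ^ r * Φ)))
      ≡⟨ move (2 ^ u) (2 ^ v) (2 ^ d) (2 ^ w) (2 ^ r) Φ ⟩
    2 ^ d * (2 ^ u * (2 ^ w * (2 ^ v * 2 ^ r))) * Φ
      ≡⟨ cong (_* Φ) powers ⟨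
    2 ^ (d + (u + (w + (v + r)))) * Φ ∎
    where
    open ≤-Reasoning
    Φ : ℕ
    Φ = ∑[ ε ← allSigns (u + v) ] φ (trues ε)
    move : ∀ u v d w r x → u * v * (d * (w * (r * x))) ≡ d * (u * (w * (v * r))) * x
    move = solve-∀
    powers : 2 ^ (d + (u + (w + (v + r)))) ≡ 2 ^ d * (2 ^ u * (2 ^ w * (2 ^ v * 2 ^ r)))
    powers rewrite ^-distribˡ-+-* 2 d (u + (w + (v + r))) | ^-distribˡ-+-* 2 u (w + (v + r))
                 | ^-distribˡ-+-* 2 w (v + r) | ^-distribˡ-+-* 2 v r = refl
    split : ∑ (allSigns (d + (u + (w + (v + r))))) F ≡
      ∑[ δ ← allSigns d ] ∑[ α ← allSigns u ] ∑[ ω ← allSigns w ] ∑[ β ← allSigns v ] ∑[ ρ ← allSigns r ] F (δ ++ (α ++ (ω ++ (β ++ ρ))))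
    split = trans (∑-signs-++ d _ F) (∑-cong (allSigns d) λ δ →
            trans (∑-signs-++ u _ _) (∑-cong (allSigns u) λ α →
            trans (∑-signs-++ w _ _) (∑-cong (allSigns w) λ ω → ∑-signs-++ v r _)))
    collect : ∑[ δ ← allSigns d ] ∑[ α ← allSigns u ] ∑[ ω ← allSigns w ] ∑[ β ← allSigns v ] ∑[ ρ ← allSigns r ] φ (trues α + falses β)
              ≡ 2 ^ d * (2 ^ w * (2 ^ r * Φ))
    collect = trans (∑-signs-const d _) (cong (2 ^ d *_) (begin-equality
      ∑[ α ← allSigns u ] ∑[ ω ← allSigns w ] ∑[ β ← allSigns v ] ∑[ ρ ← allSigns r ] φ (trues α + falses β)
        ≡⟨ ∑-cong (allSigns u) (λ α → trans (∑-signs-const w _) (cong (2 ^ w *_)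
             (trans (∑-cong (allSigns v) λ β → ∑-signs-const r _) (sym (*-distribˡ-∑ (2 ^ r) (allSigns v) _))))) ⟩
      ∑[ α ← allSigns u ] (2 ^ w * (2 ^ r * ∑[ β ← allSigns v ] φ (trues α + falses β)))
        ≡⟨ trans (cong (2 ^ w *_) (*-distribˡ-∑ (2 ^ r) (allSigns u) _)) (*-distribˡ-∑ (2 ^ w) (allSigns u) _) ⟨
      2 ^ w * (2 ^ r * ∑[ α ← allSigns u ] ∑[ β ← allSigns v ] φ (trues α + falses β))
        ≡⟨ cong (λ x → 2 ^ w * (2 ^ r * x)) (∑-trues+falses u v φ) ⟩
      2 ^ w * (2 ^ r * Φ) ∎))

-- Reduction of the energy to ordered quadruples

pos-difference-injective : ∀ x y z w → ℤ.+ x ℤ.- ℤ.+ y ≡ ℤ.+ z ℤ.- ℤ.+ w → x + w ≡ z + y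
pos-difference-injective x y z w eq = ℤ.+-injective (begin
  ℤ.+ x ℤ.+ ℤ.+ w                               ≡⟨ move₁ (ℤ.+ x) (ℤ.+ y) (ℤ.+ w) ⟩
  (ℤ.+ x ℤ.- ℤ.+ y) ℤ.+ (ℤ.+ y ℤ.+ ℤ.+ w)       ≡⟨ cong (ℤ._+ (ℤ.+ y ℤ.+ ℤ.+ w)) eq ⟩
  (ℤ.+ z ℤ.- ℤ.+ w) ℤ.+ (ℤ.+ y ℤ.+ ℤ.+ w)       ≡⟨ move₂ (ℤ.+ z) (ℤ.+ w) (ℤ.+ y) ⟩
  ℤ.+ z ℤ.+ ℤ.+ y                               ∎)
  where
  open ≡-Reasoning
  move₁ : ∀ x y w → x ℤ.+ w ≡ (x ℤ.- y) ℤ.+ (y ℤ.+ w)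
  move₁ = ℤ.solve-∀
  move₂ : ∀ z w y → (z ℤ.- w) ℤ.+ (y ℤ.+ w) ≡ z ℤ.+ y
  move₂ = ℤ.solve-∀

-- Deleting duplicates only removes summands, so quadruples of indices dominate quadruples of
-- points.
energy-map-≤ : ∀ {A : Set} (f : A → ℕ) xs → energy (map (ℤ.+_ ∘ f) xs) ≤
  ∑[ i ← xs ] ∑[ j ← xs ] ∑[ k ← xs ] ∑[ l ← xs ] ind (f i + f l ≟ f k + f j)
energy-map-≤ {A} f xs = ≤-trans
  (≤-trans (∑-mono D λ x → ≤-trans (∑-mono D λ y → ≤-trans (∑-mono D λ z → drop _) (drop _)) (drop _)) (drop _))
  (∑-mono xs λ i → ∑-mono xs λ j → ∑-mono xs λ k → ∑-mono xs λ l →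
    ind-mono (_ ℤ.≟ _) (f i + f l ≟ f k + f j) (pos-difference-injective (f i) (f j) (f k) (f l)))
  where
  L D : List ℤ
  L = map (ℤ.+_ ∘ f) xs
  D = deduplicate ℤ._≟_ L
  drop : ∀ h → ∑ D h ≤ ∑[ i ← xs ] h (ℤ.+ f i)
  drop h = ≤-trans (∑-deduplicate ℤ._≟_ L h) (≤-reflexive (∑-map _ xs h))

-- Each pair can be swapped into the order j ≤ i. The diagonal is counted twice, hence an
-- inequality.
∑-symmetric : ∀ (xs : List ℕ) (F : ℕ → ℕ → ℕ) → (∀ i j → F i j ≡ F j i) →
  ∑[ i ← xs ] ∑[ j ← xs ] F i j ≤ 2 * ∑[ i ← xs ] ∑[ j ← xs ] (ind (j ≤? i) * F i j)
∑-symmetric xs F F-sym = begin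
  ∑[ i ← xs ] ∑[ j ← xs ] F i j
    ≤⟨ ∑-mono xs (λ i → ∑-mono xs λ j → pointwise i j) ⟩
  ∑[ i ← xs ] ∑[ j ← xs ] (O i j + O j i)
    ≡⟨ trans (∑-cong xs λ i → ∑-distrib-+ xs _ _) (∑-distrib-+ xs _ _) ⟩
  ∑[ i ← xs ] ∑[ j ← xs ] O i j + ∑[ i ← xs ] ∑[ j ← xs ] O j i
    ≡⟨ cong₂ _+_ refl (trans (∑-swap xs xs (λ i j → O j i)) (sym (+-identityʳ _))) ⟩
  2 * ∑[ i ← xs ] ∑[ j ← xs ] O i j ∎
  where
  open ≤-Reasoning
  O : ℕ → ℕ → ℕ
  O i j = ind (j ≤? i) * F i j
  pointwise : ∀ i j → F i j ≤ O i j + O j i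
  pointwise i j = begin
    F i j                                              ≡⟨ *-identityˡ (F i j) ⟨
    1 * F i j                                          ≤⟨ *-monoˡ-≤ (F i j) (ind-⊎ (yes (≤-total j i)) (j ≤? i) (i ≤? j) λ p → p) ⟩
    (ind (j ≤? i) + ind (i ≤? j)) * F i j              ≡⟨ *-distribʳ-+ (F i j) (ind (j ≤? i)) _ ⟩
    O i j + ind (i ≤? j) * F i j                       ≡⟨ cong (λ x → O i j + ind (i ≤? j) * x) (F-sym i j) ⟩
    O i j + O j i                                      ∎

module _ (f : ℕ → ℕ) (N : ℕ) where

  -- The outer pair (d, a) against the inner pair (c, b). Equality of c and b is allowed: it is a
  -- three-term progression of points, with adjacent blocks.
  Coincidence : ℕ → ℕ → ℕ → ℕ → Set
  Coincidence d c b a = d < c × c ≤ b × b < a × a < N × f a + f d ≡ f c + f b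

  coincidence? : ∀ d c b a → Dec (Coincidence d c b a)
  coincidence? d c b a = (d <? c) ×-dec (c ≤? b) ×-dec (b <? a) ×-dec (a <? N) ×-dec (f a + f d ≟ f c + f b)

  coincidences : ℕ
  coincidences = ∑[ a ← upTo N ] ∑[ d ← upTo N ] ∑[ b ← upTo N ] ∑[ c ← upTo N ] ind (coincidence? d c b a)

  module _ (f-mono : ∀ {i j} → i < j → j < N → f i < f j) where

    private
      I : List ℕ
      I = upTo N

      f-reflects-< : ∀ {i j} → i < N → f i < f j → i < j
      f-reflects-< {i} {j} i<N fi<fj with <-cmp i j
      ... | tri< i<j _ _  = i<j
      ... | tri≈ _ refl _ = contradiction fi<fj (<-irrefl refl)
      ... | tri> _ _ j<i  = contradiction fi<fj (<-asym (f-mono j<i i<N))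

      f-injective : ∀ {i j} → i < N → j < N → f i ≡ f j → i ≡ j
      f-injective {i} {j} i<N j<N fi≡fj with <-cmp i j
      ... | tri< i<j _ _ = contradiction fi≡fj (<⇒≢ (f-mono i<j j<N))
      ... | tri≈ _ i≡j _ = i≡j
      ... | tri> _ _ j<i = contradiction (sym fi≡fj) (<⇒≢ (f-mono j<i i<N))

      larger-sum : ∀ {x y z w} → x + y ≡ z + w → z < x → y < w
      larger-sum {x} {y} {z} {w} eq z<x = +-cancelˡ-< z y w (begin-strict
        z + y <⟨ +-monoˡ-< y z<x ⟩
        x + y ≡⟨ eq ⟩
        z + w ∎)
        where open ≤-Reasoning

      -- For equal sums, the pair with the larger maximum has the smaller minimum and so encloses
      -- the other pair; if the maxima agree, so do the minima.
      classify : ∀ i l k j → i < N → l < N → k < N → j < N →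
        l ≤ i × j ≤ k × f i + f l ≡ f k + f j →
        (i ≡ k × l ≡ j) ⊎ Coincidence l j k i ⊎ Coincidence j l i k
      classify i l k j i<N l<N k<N j<N (l≤i , j≤k , eq) with <-cmp i k
      ... | tri≈ _ refl _ = inj₁ (refl , f-injective l<N j<N (+-cancelˡ-≡ (f i) _ _ eq))
      ... | tri> _ _ k<i  = inj₂ (inj₁ (f-reflects-< l<N (larger-sum eq (f-mono k<i i<N)) ,
                              j≤k , k<i , i<N , trans eq (+-comm (f k) (f j))))
      ... | tri< i<k _ _  = inj₂ (inj₂ (f-reflects-< j<N (larger-sum (sym eq) (f-mono i<k k<N)) ,
                              l≤i , i<k , k<N , trans (sym eq) (+-comm (f i) (f l))))

      ordered : ℕ → ℕ → ℕ → ℕ → ℕ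
      ordered i l k j = ind (l ≤? i) * (ind (j ≤? k) * ind (f i + f l ≟ f k + f j))

      diagonal : ℕ → ℕ → ℕ → ℕ → ℕ
      diagonal i l k j = ind (i ≟ k) * ind (l ≟ j)

      ordered-≤ : ∀ i l k j → i < N → l < N → k < N → j < N →
        ordered i l k j ≤ diagonal i l k j + (ind (coincidence? l j k i) + ind (coincidence? j l i k))
      ordered-≤ i l k j i<N l<N k<N j<N = begin
        ordered i l k j
          ≡⟨ trans (ind-× (l ≤? i) _) (cong (ind (l ≤? i) *_) (ind-× (j ≤? k) _)) ⟨
        ind ((l ≤? i) ×-dec (j ≤? k) ×-dec (f i + f l ≟ f k + f j))
          ≤⟨ ind-⊎ _ ((i ≟ k) ×-dec (l ≟ j)) (coincidence? l j k i ⊎-dec coincidence? j l i k) (classify i l k j i<N l<N k<N j<N) ⟩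
        ind ((i ≟ k) ×-dec (l ≟ j)) + ind (coincidence? l j k i ⊎-dec coincidence? j l i k)
          ≤⟨ +-mono-≤ (≤-reflexive (ind-× (i ≟ k) (l ≟ j))) (ind-⊎ _ (coincidence? l j k i) (coincidence? j l i k) λ p → p) ⟩
        diagonal i l k j + (ind (coincidence? l j k i) + ind (coincidence? j l i k)) ∎
        where
        open ≤-Reasoning

      ∑-diagonal : ∑[ i ← I ] ∑[ l ← I ] ∑[ k ← I ] ∑[ j ← I ] diagonal i l k j ≤ N * N
      ∑-diagonal = begin
        ∑[ i ← I ] ∑[ l ← I ] ∑[ k ← I ] ∑[ j ← I ] diagonal i l k j
          ≤⟨ ∑-mono I (λ i → ∑-mono I λ l → inner i l) ⟩
        ∑[ i ← I ] ∑[ l ← I ] 1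
          ≡⟨ trans (∑-cong I λ i → ∑-upTo-const N 1) (∑-upTo-const N (N * 1)) ⟩
        N * (N * 1)
          ≡⟨ cong (N *_) (*-identityʳ N) ⟩
        N * N ∎
        where
        open ≤-Reasoning
        inner : ∀ i l → ∑[ k ← I ] ∑[ j ← I ] diagonal i l k j ≤ 1
        inner i l = begin
          ∑[ k ← I ] ∑[ j ← I ] (ind (i ≟ k) * ind (l ≟ j))   ≡⟨ ∑-cong I (λ k → *-distribˡ-∑ (ind (i ≟ k)) I _) ⟨
          ∑[ k ← I ] (ind (i ≟ k) * ∑[ j ← I ] ind (l ≟ j))   ≤⟨ ∑-mono I (λ k → *-monoʳ-≤ (ind (i ≟ k)) (unique l)) ⟩
          ∑[ k ← I ] (ind (i ≟ k) * 1)                        ≡⟨ ∑-cong I (λ k → *-identityʳ (ind (i ≟ k))) ⟩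
          ∑[ k ← I ] ind (i ≟ k)                              ≤⟨ unique i ⟩
          1                                                   ∎
          where
          unique : ∀ i → ∑[ k ← I ] ind (i ≟ k) ≤ 1
          unique i = ∑-unique N (i ≟_) λ j k i≡j i≡k → trans (sym i≡j) i≡k

    -- The 4 pays for sorting each of the pairs {i, l} and {k, j}, the inner 2 for choosing which of
    -- them is the outer one; N² counts the case of equal pairs.
    quadruples-≤ : ∑[ i ← upTo N ] ∑[ j ← upTo N ] ∑[ k ← upTo N ] ∑[ l ← upTo N ] ind (f i + f l ≟ f k + f j)
                   ≤ 4 * (N * N + 2 * coincidences)
    quadruples-≤ = begin
      ∑[ i ← I ] ∑[ j ← I ] ∑[ k ← I ] ∑[ l ← I ] e i l k j
        ≡⟨ ∑-cong I (λ i → trans (∑-cong I λ j → ∑-swap I I _) (trans (∑-swap I I _) (∑-cong I λ l → ∑-swap I I _))) ⟩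
      ∑[ i ← I ] ∑[ l ← I ] ∑[ k ← I ] ∑[ j ← I ] e i l k j
        ≤⟨ ∑-symmetric I (λ i l → ∑[ k ← I ] ∑[ j ← I ] e i l k j)
             (λ i l → ∑-cong I λ k → ∑-cong I λ j → cong (λ x → ind (x ≟ f k + f j)) (+-comm (f i) (f l))) ⟩
      2 * ∑[ i ← I ] ∑[ l ← I ] (ind (l ≤? i) * ∑[ k ← I ] ∑[ j ← I ] e i l k j)
        ≤⟨ *-monoʳ-≤ 2 (∑-mono I λ i → ∑-mono I λ l → *-monoʳ-≤ (ind (l ≤? i))
             (∑-symmetric I (e i l) λ k j → cong (λ x → ind (f i + f l ≟ x)) (+-comm (f k) (f j)))) ⟩
      2 * ∑[ i ← I ] ∑[ l ← I ] (ind (l ≤? i) * (2 * ∑[ k ← I ] ∑[ j ← I ] (ind (j ≤? k) * e i l k j)))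
        ≡⟨ cong (2 *_) (trans (∑-cong I λ i → trans (∑-cong I λ l → factor i l) (sym (*-distribˡ-∑ 2 I _))) (sym (*-distribˡ-∑ 2 I _))) ⟩
      2 * (2 * ∑[ i ← I ] ∑[ l ← I ] ∑[ k ← I ] ∑[ j ← I ] ordered i l k j)
        ≡⟨ *-assoc 2 2 (∑⁴ ordered) ⟨
      4 * ∑[ i ← I ] ∑[ l ← I ] ∑[ k ← I ] ∑[ j ← I ] ordered i l k j
        ≤⟨ *-monoʳ-≤ 4 (∑-mono-∈ I λ i i∈ → ∑-mono-∈ I λ l l∈ → ∑-mono-∈ I λ k k∈ → ∑-mono-∈ I λ j j∈ →
             ordered-≤ i l k j (∈-upTo⁻ i∈) (∈-upTo⁻ l∈) (∈-upTo⁻ k∈) (∈-upTo⁻ j∈)) ⟩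
      4 * ∑[ i ← I ] ∑[ l ← I ] ∑[ k ← I ] ∑[ j ← I ] (diagonal i l k j + (C i l k j + C k j i l))
        ≡⟨ cong (4 *_) (trans (∑⁴-distrib-+ diagonal _) (cong (∑⁴ diagonal +_) (∑⁴-distrib-+ C λ i l k j → C k j i l))) ⟩
      4 * (∑⁴ diagonal + (∑⁴ C + ∑⁴ λ i l k j → C k j i l))
        ≡⟨ cong (λ x → 4 * (∑⁴ diagonal + (∑⁴ C + x))) (trans swap-pairs (sym (+-identityʳ (∑⁴ C)))) ⟩
      4 * (∑⁴ diagonal + 2 * ∑⁴ C)
        ≤⟨ *-monoʳ-≤ 4 (+-monoˡ-≤ (2 * ∑⁴ C) ∑-diagonal) ⟩
      4 * (N * N + 2 * ∑⁴ C) ∎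
      where
      open ≤-Reasoning
      e C : ℕ → ℕ → ℕ → ℕ → ℕ
      e i l k j = ind (f i + f l ≟ f k + f j)
      C i l k j = ind (coincidence? l j k i)
      ∑⁴ : (ℕ → ℕ → ℕ → ℕ → ℕ) → ℕ
      ∑⁴ F = ∑[ i ← I ] ∑[ l ← I ] ∑[ k ← I ] ∑[ j ← I ] F i l k j
      ∑⁴-distrib-+ : ∀ F G → ∑⁴ (λ i l k j → F i l k j + G i l k j) ≡ ∑⁴ F + ∑⁴ G
      ∑⁴-distrib-+ F G =
        trans (∑-cong I λ i → trans (∑-cong I λ l → trans (∑-cong I λ k → ∑-distrib-+ I _ _) (∑-distrib-+ I _ _)) (∑-distrib-+ I _ _)) (∑-distrib-+ I _ _)
      swap-pairs : ∑⁴ (λ i l k j → C k j i l) ≡ ∑⁴ C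
      swap-pairs = begin-equality
        ∑[ i ← I ] ∑[ l ← I ] ∑[ k ← I ] ∑[ j ← I ] C k j i l ≡⟨ ∑-cong I (λ i → ∑-swap I I _) ⟩
        ∑[ i ← I ] ∑[ k ← I ] ∑[ l ← I ] ∑[ j ← I ] C k j i l ≡⟨ ∑-swap I I _ ⟩
        ∑[ k ← I ] ∑[ i ← I ] ∑[ l ← I ] ∑[ j ← I ] C k j i l ≡⟨ ∑-cong I (λ k → trans (∑-cong I λ i → ∑-swap I I _) (∑-swap I I _)) ⟩
        ∑[ k ← I ] ∑[ j ← I ] ∑[ i ← I ] ∑[ l ← I ] C k j i l ∎
      factor : ∀ i l → ind (l ≤? i) * (2 * ∑[ k ← I ] ∑[ j ← I ] (ind (j ≤? k) * e i l k j))
                     ≡ 2 * ∑[ k ← I ] ∑[ j ← I ] ordered i l k j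
      factor i l = trans (pull (ind (l ≤? i)) _) (cong (2 *_)
        (trans (*-distribˡ-∑ (ind (l ≤? i)) I _) (∑-cong I λ k → *-distribˡ-∑ (ind (l ≤? i)) I _)))
        where
        pull : ∀ a b → a * (2 * b) ≡ 2 * (a * b)
        pull = solve-∀

  coincidences-≤ : coincidences ≤ ∑[ u ← upTo N ] ∑[ v ← upTo N ] ∑[ b ← upTo N ] ∑[ d ← upTo N ]
                                    ind (coincidence? d (d + suc u) b (b + suc v))
  coincidences-≤ = begin
    ∑[ a ← I ] ∑[ d ← I ] ∑[ b ← I ] ∑[ c ← I ] C d c b a
      ≡⟨ trans (∑-swap I I _) (∑-cong I λ d → trans (∑-swap I I _) (∑-cong I λ b → ∑-swap I I _)) ⟩
    ∑[ d ← I ] ∑[ b ← I ] ∑[ c ← I ] ∑[ a ← I ] C d c b a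
      ≤⟨ ∑-mono I (λ d → ∑-mono I λ b → ∑-mono I λ c → ∑-upTo-shift N b _ λ a a≤b →
           ind-no (coincidence? d c b a) λ (_ , _ , b<a , _) → <⇒≱ b<a a≤b) ⟩
    ∑[ d ← I ] ∑[ b ← I ] ∑[ c ← I ] ∑[ v ← I ] C d c b (b + suc v)
      ≤⟨ ∑-mono I (λ d → ∑-mono I λ b → ∑-upTo-shift N d _ λ c c≤d → ∑-zero I λ v →
           ind-no (coincidence? d c b (b + suc v)) λ (d<c , _) → <⇒≱ d<c c≤d) ⟩
    ∑[ d ← I ] ∑[ b ← I ] ∑[ u ← I ] ∑[ v ← I ] C d (d + suc u) b (b + suc v)
      ≡⟨ trans (∑-swap I I _) (trans (∑-cong I λ b → trans (∑-swap I I _) (∑-cong I λ u → ∑-swap I I _)) (trans (∑-swap I I _) (∑-cong I λ u → ∑-swap I I _))) ⟩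
    ∑[ u ← I ] ∑[ v ← I ] ∑[ b ← I ] ∑[ d ← I ] C d (d + suc u) b (b + suc v) ∎
    where
    open ≤-Reasoning
    I : List ℕ
    I = upTo N
    C : ℕ → ℕ → ℕ → ℕ → ℕ
    C d c b a = ind (coincidence? d c b a)

-- Expected number of coincidences

coincidence-count : (n u v b d : ℕ) → ℕ
coincidence-count n u v b d =
  ∑[ ε ← allSigns n ] ind (coincidence? (point 0 0 ε) (suc n) d (d + u) b (b + v))

module _ (n u v : ℕ) .{{_ : NonZero u}} where

  private
    -- The condition v < u is kept beside the equation in order to cut the later sum over v at u.
    block-solution? : ∀ k b d → Dec (v < u × Solution u v (tri u) (tri v + 2 * v) k b d)
    block-solution? k b d = (v <? u) ×-dec solution? u v (tri u) (tri v + 2 * v) k b d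

    reassociate : ∀ d u w v r → d + u + w + v + r ≡ d + (u + (w + (v + r)))
    reassociate = solve-∀

  coincidence-count-≤-solutions : ∀ b d → 2 ^ (u + v) * coincidence-count n u v b d
    ≤ 2 ^ n * ∑[ ε ← allSigns (u + v) ] ind (block-solution? (trues ε) b d)
  coincidence-count-≤-solutions b d = cases ((d + u ≤? b) ×-dec (b + v ≤? n))
    where
    cases : Dec (d + u ≤ b × b + v ≤ n) → 2 ^ (u + v) * coincidence-count n u v b d
            ≤ 2 ^ n * ∑[ ε ← allSigns (u + v) ] ind (block-solution? (trues ε) b d)
    cases (no outside) = ≤-trans (≤-reflexive (trans (cong (2 ^ (u + v) *_) empty) (*-zeroʳ (2 ^ (u + v))))) z≤n
      where
      empty : coincidence-count n u v b d ≡ 0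
      empty = ∑-zero (allSigns n) λ ε → ind-no (coincidence? (point 0 0 ε) (suc n) d (d + u) b (b + v))
        λ (_ , d+u≤b , _ , b+v≤n , _) → outside (d+u≤b , s≤s⁻¹ b+v≤n)
    cases (yes (d+u≤b , b+v≤n))
      -- The gap has length w and r steps follow the second block. Replacing n by the five-fold sum
      -- lets every sign vector be split.
      with w , refl ← m≤n⇒∃[o]m+o≡n d+u≤b
      with r , b+v+r≡n ← m≤n⇒∃[o]m+o≡n b+v≤n
      with refl ← trans (sym b+v+r≡n) (reassociate d u w v r)
      = ∑-blocks d u w v r _ (λ k → ind (block-solution? k (d + u + w) d)) λ δ α ω β ρ →
          ind-mono (coincidence? (point 0 0 (δ ++ (α ++ (ω ++ (β ++ ρ))))) _ d (d + u) (d + u + w) (d + u + w + v))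
            (block-solution? (trues α + falses β) (d + u + w) d) λ (_ , _ , _ , _ , eq) →
            let blocks = block-equation d u w v r δ α ω β ρ eq
            in block-length d u w v r α β blocks , block-solution d u w v r α β blocks

  -- There are u + v signs, but s is only tied to u, so that a single s serves all v and also the
  -- gcd bound.
  ∑-coincidence-count : ∀ N s .{{_ : NonZero s}} → s * s ≤ u →
    u * s * ∑[ b ← upTo N ] ∑[ d ← upTo N ] coincidence-count n u v b d
    ≤ 2 ^ n * (4 * (u * s) + 2 * N * (s + gcd u v))
  ∑-coincidence-count N s s²≤u = *-cancelˡ-≤ (2 ^ (u + v)) {{m^n≢0 2 (u + v)}} (begin
    2 ^ m * (u * s * ∑[ b ← I ] ∑[ d ← I ] W b d)
      ≡⟨ move₁ (2 ^ m) (u * s) _ ⟩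
    u * s * (2 ^ m * ∑[ b ← I ] ∑[ d ← I ] W b d)
      ≡⟨ cong (u * s *_) (trans (*-distribˡ-∑ (2 ^ m) I _) (∑-cong I λ b → *-distribˡ-∑ (2 ^ m) I _)) ⟩
    u * s * ∑[ b ← I ] ∑[ d ← I ] (2 ^ m * W b d)
      ≤⟨ *-monoʳ-≤ (u * s) (∑-mono I λ b → ∑-mono I λ d → ≤-trans (coincidence-count-≤-solutions b d)
           (*-monoʳ-≤ (2 ^ n) (∑-mono (allSigns m) λ ε → ind-mono (block-solution? (trues ε) b d) (sol (trues ε) b d) proj₂))) ⟩
    u * s * ∑[ b ← I ] ∑[ d ← I ] (2 ^ n * ∑[ ε ← allSigns m ] ind (sol (trues ε) b d))
      ≡⟨ cong (u * s *_) (trans (*-distribˡ-∑ (2 ^ n) I _) (∑-cong I λ b → *-distribˡ-∑ (2 ^ n) I _)) ⟨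
    u * s * (2 ^ n * ∑[ b ← I ] ∑[ d ← I ] ∑[ ε ← allSigns m ] ind (sol (trues ε) b d))
      ≡⟨ cong (λ x → u * s * (2 ^ n * x)) (trans (∑-cong I λ b → ∑-swap I (allSigns m) _) (∑-swap I (allSigns m) _)) ⟩
    u * s * (2 ^ n * ∑[ ε ← allSigns m ] ∑[ b ← I ] ∑[ d ← I ] ind (sol (trues ε) b d))
      ≡⟨ move₁ (u * s) (2 ^ n) _ ⟩
    2 ^ n * (u * s * ∑[ ε ← allSigns m ] ∑[ b ← I ] ∑[ d ← I ] ind (sol (trues ε) b d))
      ≤⟨ *-monoʳ-≤ (2 ^ n) (expected-solutions u v (tri u) (tri v + 2 * v) N m s
           (≤-trans s²≤u (m≤n⇒m≤1+n (m≤m+n u v)))) ⟩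
    2 ^ n * ((4 * (u * s) + 2 * N * (s + gcd u v)) * 2 ^ m)
      ≡⟨ move₂ (2 ^ n) _ (2 ^ m) ⟩
    2 ^ m * (2 ^ n * (4 * (u * s) + 2 * N * (s + gcd u v))) ∎)
    where
    open ≤-Reasoning
    I = upTo N
    m = u + v
    W = coincidence-count n u v
    sol = solution? u v (tri u) (tri v + 2 * v)
    move₁ : ∀ a b c → a * (b * c) ≡ b * (a * c)
    move₁ = solve-∀
    move₂ : ∀ a b c → a * (b * c) ≡ c * (a * b)
    move₂ = solve-∀

  coincidence-count-≡0 : u ≤ v → ∀ b d → coincidence-count n u v b d ≡ 0
  coincidence-count-≡0 u≤v b d = m*n≡0⇒n≡0 (2 ^ (u + v)) {{m^n≢0 2 (u + v)}} (n≤0⇒n≡0 (begin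
    2 ^ (u + v) * coincidence-count n u v b d
      ≤⟨ coincidence-count-≤-solutions b d ⟩
    2 ^ n * ∑[ ε ← allSigns (u + v) ] ind (block-solution? (trues ε) b d)
      ≡⟨ cong (2 ^ n *_) (∑-zero (allSigns (u + v)) λ ε → ind-no (block-solution? (trues ε) b d) λ (v<u , _) → <⇒≱ v<u u≤v) ⟩
    2 ^ n * 0
      ≡⟨ *-zeroʳ (2 ^ n) ⟩
    0 ∎))
    where
    open ≤-Reasoning
    m*n≡0⇒n≡0 : ∀ m {n} .{{_ : NonZero m}} → m * n ≡ 0 → n ≡ 0
    m*n≡0⇒n≡0 m {n} eq = *-cancelˡ-≡ n 0 m (trans eq (sym (*-zeroʳ m)))

∑-coincidence-count-length : ∀ n N u .{{_ : NonZero u}} → u ≤ N →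
  ∑[ v ← upTo N ] ∑[ b ← upTo N ] ∑[ d ← upTo N ] coincidence-count n u (suc v) b d ≤ 2 ^ n * (14 * N)
∑-coincidence-count-length n N u u≤N with sqrt u
... | zero , _ , u<1 = contradiction (n<1⇒n≡0 u<1) (≢-nonZero⁻¹ u)
... | s@(suc _) , s²≤u , u<t² = *-cancelˡ-≤ (u * s) {{m*n≢0 u s}} (begin
  u * s * ∑[ v ← upTo N ] W v
    ≤⟨ *-monoʳ-≤ (u * s) (∑-upTo-truncate N u W λ v u≤v → ∑-zero (upTo N) λ b → ∑-zero (upTo N) λ d →
         coincidence-count-≡0 n u (suc v) (m≤n⇒m≤1+n u≤v) b d) ⟩
  u * s * ∑[ v ← upTo u ] W v
    ≡⟨ *-distribˡ-∑ (u * s) (upTo u) W ⟩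
  ∑[ v ← upTo u ] (u * s * W v)
    ≤⟨ ∑-mono (upTo u) (λ v → ∑-coincidence-count n u (suc v) N s s²≤u) ⟩
  ∑[ v ← upTo u ] (2 ^ n * (4 * (u * s) + 2 * N * (s + gcd u (suc v))))
    ≡⟨ *-distribˡ-∑ (2 ^ n) (upTo u) _ ⟨
  2 ^ n * ∑[ v ← upTo u ] (4 * (u * s) + 2 * N * (s + gcd u (suc v)))
    ≡⟨ cong (2 ^ n *_) (trans (∑-distrib-+ (upTo u) _ _) (cong₂ _+_ (∑-upTo-const u _)
         (trans (sym (*-distribˡ-∑ (2 * N) (upTo u) _)) (cong (2 * N *_)
           (trans (∑-distrib-+ (upTo u) _ _) (cong (_+ G) (∑-upTo-const u s))))))) ⟩
  2 ^ n * (u * (4 * (u * s)) + 2 * N * (u * s + G))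
    ≤⟨ *-monoʳ-≤ (2 ^ n) (+-mono-≤ (*-monoˡ-≤ (4 * (u * s)) u≤N)
         (*-monoʳ-≤ (2 * N) (+-monoʳ-≤ (u * s) (∑-gcd u s u<t²)))) ⟩
  -- The 14 is 4 + 2 + 8: the rounding term in each pair, the main term, and the gcd error term.
  2 ^ n * (N * (4 * (u * s)) + 2 * N * (u * s + 4 * (u * s)))
    ≡⟨ move (2 ^ n) N (u * s) ⟩
  u * s * (2 ^ n * (14 * N)) ∎)
  where
  open ≤-Reasoning
  W : ℕ → ℕ
  W v = ∑[ b ← upTo N ] ∑[ d ← upTo N ] coincidence-count n u (suc v) b d
  G : ℕ
  G = ∑[ v ← upTo u ] gcd u (suc v)
  move : ∀ p N x → p * (N * (4 * x) + 2 * N * (x + 4 * x)) ≡ x * (p * (14 * N))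
  move = solve-∀

∑-coincidences : ∀ n → ∑[ ε ← allSigns n ] coincidences (point 0 0 ε) (suc n) ≤ 2 ^ n * (14 * (suc n * suc n))
∑-coincidences n = begin
  ∑[ ε ← ℰ ] coincidences (point 0 0 ε) N
    ≤⟨ ∑-mono ℰ (λ ε → coincidences-≤ (point 0 0 ε) N) ⟩
  ∑[ ε ← ℰ ] ∑[ u ← I ] ∑[ v ← I ] ∑[ b ← I ] ∑[ d ← I ] C ε u v b d
    ≡⟨ trans (∑-swap ℰ I _) (∑-cong I λ u → trans (∑-swap ℰ I _) (∑-cong I λ v →
         trans (∑-swap ℰ I _) (∑-cong I λ b → ∑-swap ℰ I λ ε d → C ε u v b d))) ⟩
  ∑[ u ← I ] ∑[ v ← I ] ∑[ b ← I ] ∑[ d ← I ] coincidence-count n (suc u) (suc v) b d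
    ≤⟨ ∑-mono-∈ I (λ u u∈ → ∑-coincidence-count-length n N (suc u) (∈-upTo⁻ u∈)) ⟩
  ∑[ u ← I ] (2 ^ n * (14 * N))
    ≡⟨ ∑-upTo-const N _ ⟩
  N * (2 ^ n * (14 * N))
    ≡⟨ move (2 ^ n) N ⟩
  2 ^ n * (14 * (N * N)) ∎
  where
  open ≤-Reasoning
  N = suc n
  ℰ = allSigns n
  I = upTo N
  C : Vec Bool n → ℕ → ℕ → ℕ → ℕ → ℕ
  C ε u v b d = ind (coincidence? (point 0 0 ε) N d (d + suc u) b (b + suc v))
  move : ∀ p N → N * (p * (14 * N)) ≡ p * (14 * (N * N))
  move = solve-∀

energyP-≤ : ∀ {n} (ε : Vec Bool n) →
            energyP ε ≤ 4 * (suc n * suc n + 2 * coincidences (point 0 0 ε) (suc n))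
energyP-≤ {n} ε rewrite psums≡points 0 0 ε = ≤-trans (energy-map-≤ (point 0 0 ε) (upTo (suc n)))
  (quadruples-≤ (point 0 0 ε) (suc n) λ i<j j≤n → point-strictMono 0 0 ε i<j (s≤s⁻¹ j≤n))

totalEnergy-≤ : ∀ n → totalEnergy n ≤ 116 * (suc n * suc n) * 2 ^ n
totalEnergy-≤ n = begin
  ∑ ℰ energyP                                        ≤⟨ ∑-mono ℰ energyP-≤ ⟩
  ∑[ ε ← ℰ ] (4 * (N² + 2 * K ε))                    ≡⟨ *-distribˡ-∑ 4 ℰ _ ⟨
  4 * ∑[ ε ← ℰ ] (N² + 2 * K ε)                      ≡⟨ cong (4 *_) (trans (∑-distrib-+ ℰ _ _)
                                                          (cong₂ _+_ (∑-signs-const n N²) (sym (*-distribˡ-∑ 2 ℰ K)))) ⟩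
  4 * (2 ^ n * N² + 2 * ∑ ℰ K)                       ≤⟨ *-monoʳ-≤ 4 (+-monoʳ-≤ (2 ^ n * N²) (*-monoʳ-≤ 2 (∑-coincidences n))) ⟩
  -- 116 = 4 (1 + 2 · 14).
  4 * (2 ^ n * N² + 2 * (2 ^ n * (14 * N²)))         ≡⟨ move (2 ^ n) N² ⟩
  116 * N² * 2 ^ n                                   ∎
  where
  open ≤-Reasoning
  ℰ = allSigns n
  N² : ℕ
  N² = suc n * suc n
  K : Vec Bool n → ℕ
  K ε = coincidences (point 0 0 ε) (suc n)
  move : ∀ p x → 4 * (p * x + 2 * (p * (14 * x))) ≡ 116 * x * p
  move = solve-∀

theorem2p1 : Σ ℕ (λ C → (C > 0) × ((n : ℕ) → n ≥ 1 → totalEnergy n ≤ C * (n * n) * 2 ^ n))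
theorem2p1 = 464 , z<s , λ n n≥1 → ≤-trans (totalEnergy-≤ n) (*-monoˡ-≤ (2 ^ n) (begin
  -- There are n + 1 ≤ 2 n points, whence 464 = 4 · 116.
  116 * (suc n * suc n)             ≤⟨ *-monoʳ-≤ 116 (*-mono-≤ (+-monoˡ-≤ n n≥1) (+-monoˡ-≤ n n≥1)) ⟩
  116 * ((n + n) * (n + n))         ≡⟨ move n ⟩
  464 * (n * n)                     ∎))
  where
  open ≤-Reasoning
  move : ∀ n → 116 * ((n + n) * (n + n)) ≡ 464 * (n * n)
  move = solve-∀
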